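{- Let $T$ be a tree with at least three vertices such that $n_2(T)\leq n_1(T)$. If $|E(T)|\leq 2(n_1(T)+1)$, then $\chi'_{es}(T)=\chi'_s(T)$.
   Context: All graphs are finite and simple. A proper edge $k$-coloring of a graph $G$ is a vertex distinguishing edge $k$-coloring (vdec) if for any two distinct vertices $u,v$ the set of colors on edges incident to $u$ differs from that of $v$. $\chi'_s(G)$ is the minimum $k$ such that $G$ has a $k$-vdec. A $k$-vdec $\pi$ is equitable if the color classes $S_i=\{e:\pi(e)=i\}$, $i\in[1,k]$, pairwise differ in size by at most one; $\chi'_{es}(G)$ is the minimum $k$ such that $G$ has an equitable $k$-vdec. $n_d(G)$ is the number of vertices of degree $d$. -}

module Defs where

open import Data.Nat as ℕ using (ℕ; suc; _≤_)
open import Data.Fin as Fin using (Fin; _≟_)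
open import Data.Fin.Properties using () renaming (_≟_ to _≟ᶠ_)
open import Data.List using (List; []; _∷_; length; lookup; filter; allFin)
open import Data.List.Relation.Unary.All using (All)
open import Data.List.Relation.Unary.Unique.Propositional using (Unique)
open import Data.Product using (_×_; _,_; proj₁; proj₂; Σ; ∃)
open import Data.Sum using (_⊎_)
import Data.Unit
import Data.Maybe
import Data.List
open import Relation.Binary.PropositionalEquality using (_≡_)
open import Relation.Binary.Construct.Closure.ReflexiveTransitive using (Star)
open import Relation.Nullary using (¬_; Dec)
open import Relation.Nullary.Decidable using (_⊎-dec_)
open import Function.Bundles using (_⇔_)

-- Finite simple graphs on the vertex set Fin n.
-- An edge {u,v} is stored once, as the ordered pair (u , v) with u < v;
-- the edge list has no duplicates.  (So: no loops, no multi-edges.)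

record Graph (n : ℕ) : Set where
  field
    edges   : List (Fin n × Fin n)
    ordered : All (λ e → proj₁ e Fin.< proj₂ e) edges
    simple  : Unique edges
open Graph public

Edge : ∀ {n} → Graph n → Set
Edge G = Fin (length (edges G))

ends : ∀ {n} (G : Graph n) → Edge G → Fin n × Fin n
ends G i = lookup (edges G) i

∣E∣ : ∀ {n} → Graph n → ℕ
∣E∣ G = length (edges G)

Incident : ∀ {n} (G : Graph n) → Fin n → Edge G → Set
Incident G v e = proj₁ (ends G e) ≡ v ⊎ proj₂ (ends G e) ≡ v

incident? : ∀ {n} (G : Graph n) (v : Fin n) (e : Edge G) → Dec (Incident G v e)
incident? G v e = (proj₁ (ends G e) ≟ᶠ v) ⊎-dec (proj₂ (ends G e) ≟ᶠ v)

Adj : ∀ {n} (G : Graph n) → Fin n → Fin n → Set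
Adj G u v = Σ (Edge G) λ e → (ends G e ≡ (u , v)) ⊎ (ends G e ≡ (v , u))

degree : ∀ {n} (G : Graph n) → Fin n → ℕ
degree G v = length (filter (incident? G v) (allFin (∣E∣ G)))

n[_] : ℕ → ∀ {n} → Graph n → ℕ
n[ d ] {n} G = length (filter (λ v → degree G v ℕ.≟ d) (allFin n))

Connected : ∀ {n} → Graph n → Set
Connected {n} G = ∀ (u v : Fin n) → Star (Adj G) u v

Chain : ∀ {n} (G : Graph n) → List (Fin n) → Set
Chain G []           = Data.Unit.⊤
Chain G (x ∷ [])     = Data.Unit.⊤
Chain G (x ∷ y ∷ vs) = Adj G x y × Chain G (y ∷ vs)

Cycle : ∀ {n} (G : Graph n) → Set
Cycle {n} G = Σ (List (Fin n)) λ vs →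
  Σ (Fin n) λ v₀ → Σ (Fin n) λ vₗ →
    (3 ≤ length vs) × Unique vs × Chain G vs ×
    (Data.List.head vs ≡ Data.Maybe.just v₀) ×
    (Data.List.last vs ≡ Data.Maybe.just vₗ) × Adj G vₗ v₀

Acyclic : ∀ {n} → Graph n → Set
Acyclic G = ¬ Cycle G

IsTree : ∀ {n} → Graph n → Set
IsTree G = Connected G × Acyclic G

Colouring : ∀ {n} → Graph n → ℕ → Set
Colouring G k = Edge G → Fin k

Proper : ∀ {n} (G : Graph n) {k} → Colouring G k → Set
Proper {n} G π = ∀ (v : Fin n) (e f : Edge G) →
  Incident G v e → Incident G v f → ¬ e ≡ f → ¬ π e ≡ π f

InColourSet : ∀ {n} (G : Graph n) {k} → Colouring G k → Fin n → Fin k → Set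
InColourSet G π v a = Σ (Edge G) λ e → Incident G v e × π e ≡ a

SameColourSet : ∀ {n} (G : Graph n) {k} → Colouring G k → Fin n → Fin n → Set
SameColourSet G {k} π u v = ∀ (a : Fin k) → InColourSet G π u a ⇔ InColourSet G π v a

IsVdec : ∀ {n} (G : Graph n) {k} → Colouring G k → Set
IsVdec {n} G π = Proper G π ×
  (∀ (u v : Fin n) → ¬ u ≡ v → ¬ SameColourSet G π u v)

classSize : ∀ {n} (G : Graph n) {k} → Colouring G k → Fin k → ℕ
classSize G π a = length (filter (λ e → π e ≟ᶠ a) (allFin (∣E∣ G)))

Equitable : ∀ {n} (G : Graph n) {k} → Colouring G k → Set
Equitable G {k} π = ∀ (a b : Fin k) → classSize G π a ≤ suc (classSize G π b)

HasVdec : ∀ {n} → Graph n → ℕ → Set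
HasVdec G k = Σ (Colouring G k) λ π → IsVdec G π

HasEquitableVdec : ∀ {n} → Graph n → ℕ → Set
HasEquitableVdec G k = Σ (Colouring G k) λ π → IsVdec G π × Equitable G π

IsChiS : ∀ {n} → Graph n → ℕ → Set
IsChiS G k = HasVdec G k × (∀ j → HasVdec G j → k ≤ j)

IsChiES : ∀ {n} → Graph n → ℕ → Set
IsChiES G k = HasEquitableVdec G k × (∀ j → HasEquitableVdec G j → k ≤ j)

{-# OPTIONS --safe #-}
module Submission where

-- Let k = n₁(T), let m be the number of inner edges, and let κ be a fresh colour.  Two moves turn
-- a vertex distinguishing colouring of a smaller tree into one of T using κ on one pendant edge
-- and one inner edge, without changing the other class sizes (and hence equitability):
--   * hang a leg u – a – ℓ on a vertex u having an inner edge uy of colour α: recolour uy with κ and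
--     give α to ua and κ to aℓ;
--   * hang a leaf of colour κ on a vertex u and subdivide an inner edge xy of colour γ by z: one of
--     xz, zy keeps γ and the other gets κ.  If both choices failed, the star of u would be that of x
--     and that of y with γ replaced by κ, so x and y would have had equal colour sets.
-- Hanging only a leaf of colour κ always works and lowers m - k.  Counting leaves against edges shows
-- that for k ≥ 3 the last move can be undone when m < k, and one of the first two when k ≤ m ≤ k + 2.
-- For m ≥ 3 this leads to trees with (k , m) among (3 , 3), (4 , 5), (5 , 6), (5 , 7), which are
-- coloured by search (n₂ ≤ n₁ only excludes small trees).  For m ≤ 2 every such k-colouring
-- is equitable, and there is always an equitable colouring with k or k + 1 colours.

-- The `k` leaves have distinct one-element colour sets, so every vdec has at least `k` colours, and
-- an equitable one with exactly `k` settles both numbers. With `k` colours each colour lies on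
-- exactly one pendant edge, and only the `m` inner edges remain to be spread; the bound on the
-- edges says m ≤ k + 2. A new class of size two fits among classes of sizes 1 and 2 (`lo` = 0) as
-- well as 2 and 3 (`lo` = 1); a leaf alone adds a class of size one and so requires `lo` = 0. The
-- first two moves preserve m - k, so each of its values 0, 1 and 2 needs base trees of its own.
-- Undoing a move can lower n₁ without lowering n₂, since a vertex of degree three may become one of
-- degree two. The hypothesis n₂ ≤ n₁ is therefore not inherited by smaller trees, and for m > k the
-- induction starts from all trees with five leaves. For m = 1, 2 it is decided by search whether
-- `k` colours suffice; if not, both numbers are k + 1.

open import Defs
open import Data.Bool using (Bool; true; false; if_then_else_; _∧_; _∨_; T)
open import Data.Empty using (⊥; ⊥-elim)
open import Data.Fin as Fin using (Fin; zero; suc; toℕ; fromℕ<)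
import Data.Fin.Properties as FinP
open import Data.List
  using (List; []; _∷_; _++_; map; length; filter; lookup; head; last; upTo; allFin; concatMap; cartesianProductWith)
open import Data.List.Membership.Propositional using (_∈_; _∉_; find; lose)
open import Data.List.Membership.Propositional.Properties
  using (∈-++⁺ˡ; ∈-++⁺ʳ; ∈-++⁻; ∈-map⁺; ∈-map⁻; ∈-lookup; ∈-allFin;
         ∈-∃++; ∈-upTo⁺; ∈-filter⁺; ∈-filter⁻; ∈-concatMap⁺; ∈-cartesianProductWith⁺)
open import Data.List.Membership.Propositional.Properties.WithK using (unique∧set⇒bag)
open import Data.List.Properties
  using (map-++; map-∘; length-map; length-++; length-tabulate; length-upTo;
         filter-++; filter-accept; filter-reject; filter-none; ++-identityʳ)
open import Data.List.Relation.Binary.BagAndSetEquality using (∼bag⇒↭)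
import Data.List.Relation.Binary.Permutation.Homogeneous as Homogeneous
open import Data.List.Relation.Binary.Permutation.Propositional as ↭
  using (_↭_; ↭-refl; ↭-sym; ↭-trans; prep; swap; ↭-setoid; ↭⇒↭ₛ)
open import Data.List.Relation.Binary.Permutation.Propositional.Properties
  using (shift; shifts; ++⁺ˡ; ++⁺ʳ; ++-comm; ∈-resp-↭; filter-↭; ↭-length; All-resp-↭)
import Data.List.Relation.Binary.Permutation.Setoid as PermS
import Data.List.Relation.Binary.Permutation.Setoid.Properties as PermSP
open import Data.List.Relation.Unary.All as All using (All; []; _∷_)
open import Data.List.Relation.Unary.All.Properties as AllP using (++⁻ˡ; ++⁻ʳ; ¬All⇒Any¬)
open import Data.List.Relation.Unary.AllPairs as AllPairs using (AllPairs; []; _∷_)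
import Data.List.Relation.Unary.AllPairs.Properties as APP
open import Data.List.Relation.Unary.Any using (here; there)
open import Data.List.Relation.Unary.Unique.Propositional using (Unique)
import Data.List.Relation.Unary.Unique.Propositional.Properties as UniqueP
open import Data.Maybe using (Maybe; just; nothing; _<∣>_)
open import Data.Nat
open import Data.Nat.Properties
open import Data.Nat.Solver using (module +-*-Solver)
open import Data.Product using (Σ; ∃; _×_; _,_; proj₁; proj₂)
open import Data.Sum using (_⊎_; inj₁; inj₂)
open import Data.Unit using (⊤; tt)
open import Function.Base using (_∘_; id)
open import Function.Bundles using (mk⇔; Equivalence)
open import Relation.Binary.Construct.Closure.ReflexiveTransitive using (Star; ε; _◅_)
open import Relation.Binary.PropositionalEquality
  using (_≡_; _≢_; ≢-sym; refl; sym; trans; cong; cong₂; subst; subst₂; setoid)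
open import Relation.Nullary
open import Relation.Nullary.Decidable using (_×-dec_; _→-dec_; map′; decidable-stable)
import Data.List.Membership.DecPropositional as DecMem
open DecMem _≟_ using (_∈?_)
open import Data.List.Relation.Unary.Unique.DecPropositional _≟_ using (unique?)

-- Rooted shapes and their labellings

-- Rooted trees in first-child/next-sibling form: br c s is the tree s whose root has got one more
-- child, the root of c.  So br c s and br s c are the same tree rooted at the two ends of an edge.
data Shape : Set where
  ∅  : Shape
  br : (child siblings : Shape) → Shape

-- Labellings of the edges.
data Lab (A : Set) : Shape → Set where
  ∅  : Lab A ∅
  br : ∀ {c s} → A → Lab A c → Lab A s → Lab A (br c s)

private variable
  A : Set
  t : Shape

-- The star of a vertex is the list of labels of its edges; below omits the star of the root.
heads : Lab A t → List A
heads ∅          = []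
heads (br a c s) = a ∷ heads s

below : Lab A t → List (List A)
below ∅          = []
below (br a c s) = (a ∷ heads c) ∷ below c ++ below s

stars : Lab A t → List (List A)
stars c = heads c ∷ below c

labels : Lab A t → List A
labels ∅          = []
labels (br a c s) = a ∷ labels c ++ labels s

Same Differ : List ℕ → List ℕ → Set
Same xs ys = (∀ x → x ∈ xs → x ∈ ys) × (∀ x → x ∈ ys → x ∈ xs)
Differ xs ys = ¬ Same xs ys

count : ℕ → List ℕ → ℕ
count x ys = length (filter (x ≟_) ys)

Balanced : ℕ → ℕ → List ℕ → Set
Balanced K lo xs = ∀ x → x < K → suc lo ≤ count x xs × count x xs ≤ 2 + lo

record Vdec (c : Lab ℕ t) : Set where
  constructor vdec
  field
    proper   : All Unique (stars c)
    distinct : AllPairs Differ (stars c)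

-- With all class sizes in {lo + 1, lo + 2} the colouring is equitable.
record Good (K lo : ℕ) (c : Lab ℕ t) : Set where
  field
    bounded  : All (_< K) (labels c)
    balanced : Balanced K lo (labels c)
    isVdec   : Vdec c
  open Vdec isVdec public

Colourable : ℕ → ℕ → Shape → Set
Colourable K lo t = Σ (Lab ℕ t) (Good K lo)

size : Shape → ℕ
size ∅        = 0
size (br c s) = suc (size c + size s)

-- leaves and btwos do not count the root; pleaves and ptwos (planted) count its edge to a parent
-- in its degree; nleaves and twos count the vertices of degree 1 and 2 of the whole tree.
leaves pleaves : Shape → ℕ
leaves ∅        = 0
leaves (br c s) = pleaves c + leaves s
pleaves ∅          = 1
pleaves (br c s)   = leaves (br c s)

infixr 5 _⊕_
_⊕_ : Shape → Shape → Shape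
∅      ⊕ t = t
br c s ⊕ t = br c (s ⊕ t)

-- Re-rooting

-- Equality of unrooted, unordered trees, as far as it is needed.
infix 4 _≈_
data _≈_ : Shape → Shape → Set where
  ≈-refl  : ∀ {t} → t ≈ t
  ≈-trans : ∀ {t u v} → t ≈ u → u ≈ v → t ≈ v
  rot     : ∀ {c s} → br c s ≈ br s c
  front   : ∀ s {c s'} → s ⊕ br c s' ≈ br c (s ⊕ s')
  back    : ∀ s {c s'} → br c (s ⊕ s') ≈ s ⊕ br c s'

≈-sym : ∀ {t u} → t ≈ u → u ≈ t
≈-sym ≈-refl        = ≈-refl
≈-sym (≈-trans p q) = ≈-trans (≈-sym q) (≈-sym p)
≈-sym rot           = rot
≈-sym (front s)     = back s
≈-sym (back s)      = front s

module _ {A : Set} where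

  pull : ∀ s {c s'} → Lab A (s ⊕ br c s') → Lab A (br c (s ⊕ s'))
  pull ∅        x = x
  pull (br d s) (br a u v) with pull s v
  ... | br b c w = br b c (br a u w)

  push : ∀ s {c s'} → Lab A (br c (s ⊕ s')) → Lab A (s ⊕ br c s')
  push ∅        x                     = x
  push (br d s) (br b c (br a u w)) = br a u (push s (br b c w))

  -- Proofs of `≈` are data because they compute: each one carries a labelling edge by edge to the
  -- other rooting, which only permutes the labels and the stars.
  relabel : ∀ {t t'} → t ≈ t' → Lab A t → Lab A t'
  relabel ≈-refl        x          = x
  relabel (≈-trans p q) x          = relabel q (relabel p x)
  relabel rot           (br a c s) = br a s c
  relabel (front s)     x          = pull s x
  relabel (back s)      x          = push s x

  pull-heads : ∀ s {c s'} (x : Lab A (s ⊕ br c s')) → heads x ↭ heads (pull s x)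
  pull-heads ∅        x = ↭-refl
  pull-heads (br d s) (br a u v) with pull s v | pull-heads s v
  ... | br b c w | p = ↭-trans (prep a p) (swap a b ↭-refl)

  pull-below : ∀ s {c s'} (x : Lab A (s ⊕ br c s')) → below x ↭ below (pull s x)
  pull-below ∅        x = ↭-refl
  pull-below (br d s) (br a u v) with pull s v | pull-below s v
  ... | br b c w | p = ↭-trans (++⁺ˡ ((a ∷ heads u) ∷ below u) p)
                               (shifts ((a ∷ heads u) ∷ below u) ((b ∷ heads c) ∷ below c))

  pull-labels : ∀ s {c s'} (x : Lab A (s ⊕ br c s')) → labels x ↭ labels (pull s x)
  pull-labels ∅        x = ↭-refl
  pull-labels (br d s) (br a u v) with pull s v | pull-labels s v
  ... | br b c w | p = ↭-trans (++⁺ˡ (a ∷ labels u) p) (shifts (a ∷ labels u) (b ∷ labels c))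

  pull-push : ∀ s {c s'} (x : Lab A (br c (s ⊕ s'))) → pull s (push s x) ≡ x
  pull-push ∅ x = refl
  pull-push (br d s) (br b c (br a u w)) rewrite pull-push s (br b c w) = refl

  relabel-labels : ∀ {t t'} (p : t ≈ t') (x : Lab A t) → labels x ↭ labels (relabel p x)
  relabel-labels ≈-refl        x = ↭-refl
  relabel-labels (≈-trans p q) x = ↭-trans (relabel-labels p x) (relabel-labels q (relabel p x))
  relabel-labels rot (br a c s)  = prep a (++-comm (labels c) (labels s))
  relabel-labels (front s)     x = pull-labels s x
  relabel-labels (back s)      x = ↭-sym (subst (λ y → labels (push s x) ↭ labels y) (pull-push s x)
      (pull-labels s (push s x)))

  -- Re-rooting reorders the list of stars and also the labels inside a star; `≋` allows both.
  open PermS (↭-setoid {A = A}) public using () renaming (_↭_ to _≋_)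
  private module PP = PermSP (↭-setoid {A = A})
  private module PS = PermS (↭-setoid {A = A})

  ↭⇒≋ : {xs ys : List (List A)} → xs ↭ ys → xs ≋ ys
  ↭⇒≋ p = Homogeneous.map ↭.↭-reflexive (↭⇒↭ₛ p)

  relabel-stars : ∀ {t t'} (p : t ≈ t') (x : Lab A t) → stars x ≋ stars (relabel p x)
  relabel-stars ≈-refl        x = PS.↭-refl
  relabel-stars (≈-trans p q) x = PS.↭-trans (relabel-stars p x) (relabel-stars q (relabel p x))
  relabel-stars rot (br a c s)  = ↭⇒≋ (swap _ _ (++-comm (below c) (below s)))
  relabel-stars (front s)     x = PS.prep (pull-heads s x) (↭⇒≋ (pull-below s x))
  relabel-stars (back s)      x = PS.↭-sym (subst (λ y → stars (push s x) ≋ stars y) (pull-push s x)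
                                    (PS.prep (pull-heads s (push s x)) (↭⇒≋ (pull-below s (push s x)))))

  All-≋ : ∀ {P : List A → Set} → (∀ {xs ys} → xs ↭ ys → P xs → P ys) →
          ∀ {xs ys} → xs ≋ ys → All P xs → All P ys
  All-≋ resp p = PP.All-resp-↭ resp p

  AllPairs-≋ : ∀ {R : List A → List A → Set} → (∀ {xs ys} → R xs ys → R ys xs) →
               (∀ {xs ys zs} → ys ↭ zs → R xs ys → R xs zs) →
               ∀ {xs ys} → xs ≋ ys → AllPairs R xs → AllPairs R ys
  AllPairs-≋ s r p = PP.AllPairs-resp-↭ s (r , λ e x → s (r e (s x))) p

Unique-↭ : {A : Set} {xs ys : List A} → xs ↭ ys → Unique xs → Unique ys
Unique-↭ p = PermSP.Unique-resp-↭ (setoid _) (↭⇒↭ₛ p)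

↭⇒Same : {xs ys : List ℕ} → xs ↭ ys → Same xs ys
↭⇒Same p = (λ _ → ∈-resp-↭ p) , (λ _ → ∈-resp-↭ (↭-sym p))

Same-sym : ∀ {xs ys} → Same xs ys → Same ys xs
Same-sym (f , g) = g , f

Same-trans : ∀ {xs ys zs} → Same xs ys → Same ys zs → Same xs zs
Same-trans (f , g) (f' , g') = (λ x i → f' x (f x i)) , (λ x i → g x (g' x i))

count-↭ : ∀ x {xs ys} → xs ↭ ys → count x xs ≡ count x ys
count-↭ x p = ↭-length (filter-↭ (x ≟_) p)

Differ-sym : ∀ {xs ys} → Differ xs ys → Differ ys xs
Differ-sym d e = d (Same-sym e)

Distinct-≋ : ∀ {xs ys : List (List ℕ)} → xs ≋ ys → AllPairs Differ xs → AllPairs Differ ys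
Distinct-≋ = AllPairs-≋ Differ-sym (λ q d e → d (Same-trans e (Same-sym (↭⇒Same q))))

Vdec-≋ : ∀ {t t'} {c : Lab ℕ t} {c' : Lab ℕ t'} → stars c ≋ stars c' → Vdec c → Vdec c'
Vdec-≋ p (vdec u d) = vdec (All-≋ Unique-↭ p u) (Distinct-≋ p d)

Good-≈ : ∀ {K lo t t'} (p : t ≈ t') {c : Lab ℕ t} → Good K lo c → Good K lo (relabel p c)
Good-≈ p {c} g = record
  { bounded  = All-resp-↭ (relabel-labels p c) (Good.bounded g)
  ; balanced = λ x x<K → subst (λ n → _ ≤ n × n ≤ _) (count-↭ x (relabel-labels p c)) (Good.balanced g x x<K)
  ; isVdec   = Vdec-≋ (relabel-stars p c) (Good.isVdec g)
  }

Colourable-≈ : ∀ {K lo t t'} → t ≈ t' → Colourable K lo t → Colourable K lo t'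
Colourable-≈ p (c , g) = relabel p c , Good-≈ p g

-- Leaves, edges and vertices of degree two under re-rooting

nleaves : Shape → ℕ
nleaves ∅        = 0
nleaves (br c s) = pleaves c + pleaves s

leaves-⊕ : ∀ s t → leaves (s ⊕ t) ≡ leaves s + leaves t
leaves-⊕ ∅ t = refl
leaves-⊕ (br c s) t = trans (cong (pleaves c +_) (leaves-⊕ s t)) (sym (+-assoc (pleaves c) _ _))

size-⊕ : ∀ s t → size (s ⊕ t) ≡ size s + size t
size-⊕ ∅ t = refl
size-⊕ (br c s) t = cong suc (trans (cong (size c +_) (size-⊕ s t)) (sym (+-assoc (size c) _ _)))

+-exchange : ∀ x y z → x + (y + z) ≡ y + (x + z)
+-exchange x y z = trans (sym (+-assoc x y z)) (trans (cong (_+ z) (+-comm x y)) (+-assoc y x z))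

leaves-front : ∀ s c s' → leaves (s ⊕ br c s') ≡ leaves (br c (s ⊕ s'))
leaves-front s c s' = trans (leaves-⊕ s (br c s')) (trans (+-exchange (leaves s) (pleaves c) (leaves s'))
    (cong (pleaves c +_) (sym (leaves-⊕ s s'))))

size-front : ∀ s c s' → size (s ⊕ br c s') ≡ size (br c (s ⊕ s'))
size-front s c s' = trans (size-⊕ s (br c s')) (trans (+-suc (size s) _) (cong suc (trans (+-exchange
    (size s) (size c) (size s')) (cong (size c +_) (sym (size-⊕ s s'))))))

pleaves-front : ∀ s c s' → pleaves (s ⊕ br c s') ≡ leaves (s ⊕ br c s')
pleaves-front ∅ c s' = refl
pleaves-front (br d s) c s' = refl

nleaves-front : ∀ s c s' → nleaves (s ⊕ br c s') ≡ nleaves (br c (s ⊕ s'))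
nleaves-front ∅ c s' = refl
nleaves-front (br d s) c s' = trans (cong (pleaves d +_) (trans (pleaves-front s c s')
    (leaves-front s c s'))) (+-exchange (pleaves d) (pleaves c) _)

size-≈ : ∀ {t t'} → t ≈ t' → size t ≡ size t'
size-≈ ≈-refl = refl
size-≈ (≈-trans p q) = trans (size-≈ p) (size-≈ q)
size-≈ (rot {c} {s}) = cong suc (+-comm (size c) (size s))
size-≈ (front s) = size-front s _ _
size-≈ (back s) = sym (size-front s _ _)

nleaves-≈ : ∀ {t t'} → t ≈ t' → nleaves t ≡ nleaves t'
nleaves-≈ ≈-refl = refl
nleaves-≈ (≈-trans p q) = trans (nleaves-≈ p) (nleaves-≈ q)
nleaves-≈ (rot {c} {s}) = +-comm (pleaves c) (pleaves s)
nleaves-≈ (front s) = nleaves-front s _ _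
nleaves-≈ (back s) = sym (nleaves-front s _ _)

single : Shape → ℕ
single (br _ ∅) = 1
single _        = 0

btwos ptwos : Shape → ℕ
btwos ∅        = 0
btwos (br c s) = ptwos c + btwos s
ptwos c = single c + btwos c

twos : Shape → ℕ
twos ∅        = 0
twos (br c s) = ptwos c + ptwos s

btwos-⊕ : ∀ s t → btwos (s ⊕ t) ≡ btwos s + btwos t
btwos-⊕ ∅ t = refl
btwos-⊕ (br c s) t = trans (cong (ptwos c +_) (btwos-⊕ s t)) (sym (+-assoc (ptwos c) _ _))

single-front : ∀ d s c s' → single (s ⊕ br c s') ≡ single (br d (s ⊕ s'))
single-front d ∅ c ∅ = refl
single-front d ∅ c (br _ _) = refl
single-front d (br _ ∅) c s' = refl
single-front d (br _ (br _ s)) c s' = refl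

twos-front : ∀ s c s' → twos (s ⊕ br c s') ≡ twos (br c (s ⊕ s'))
twos-front ∅ c s' = refl
twos-front (br d s) c s'
  rewrite single-front d s c s' | btwos-⊕ s (br c s') | btwos-⊕ s s' =
  solve 5 (λ pd sg bs pc bs' → pd :+ (sg :+ (bs :+ (pc :+ bs'))) := pc :+ (sg :+ (pd :+ (bs :+ bs')))) refl
    (ptwos d) (single (br d (s ⊕ s'))) (btwos s) (ptwos c) (btwos s')
  where open +-*-Solver

twos-≈ : ∀ {t t'} → t ≈ t' → twos t ≡ twos t'
twos-≈ ≈-refl = refl
twos-≈ (≈-trans p q) = trans (twos-≈ p) (twos-≈ q)
twos-≈ (rot {c} {s}) = +-comm (ptwos c) (ptwos s)
twos-≈ (front s) = twos-front s _ _
twos-≈ (back s) = sym (twos-front s _ _)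

-- Comparing colour sets

differ : ∀ {x xs ys} → x ∈ xs → x ∉ ys → Differ xs ys
differ i j (f , _) = j (f _ i)

unique-↭ : ∀ {A : Set} {xs ys : List A} → Unique xs → Unique ys →
           (∀ {x} → x ∈ xs → x ∈ ys) → (∀ {x} → x ∈ ys → x ∈ xs) → xs ↭ ys
unique-↭ u v f g = ∼bag⇒↭ (unique∧set⇒bag u v (mk⇔ f g))

same-↭ : ∀ {xs ys} → Unique xs → Unique ys → Same xs ys → xs ↭ ys
same-↭ u v (f , g) = unique-↭ u v (f _) (g _)

same-length : ∀ {xs ys} → Unique xs → Unique ys → Same xs ys → length xs ≡ length ys
same-length u v e = ↭-length (same-↭ u v e)

same? : ∀ xs ys → Dec (Same xs ys)
same? xs ys = map′
  (λ (p , q) → (λ _ → All.lookup p) , (λ _ → All.lookup q))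
  (λ (f , g) → All.tabulate (f _) , All.tabulate (g _))
  (All.all? (_∈? ys) xs ×-dec All.all? (_∈? xs) ys)

AllPairs-∈ : ∀ {A : Set} {R : A → A → Set} {xs : List A} → AllPairs R xs →
             ∀ {x y} → x ∈ xs → y ∈ xs → x ≡ y ⊎ R x y ⊎ R y x
AllPairs-∈ (p ∷ ps) (here refl) (here refl) = inj₁ refl
AllPairs-∈ (p ∷ ps) (here refl) (there j)   = inj₂ (inj₁ (All.lookup p j))
AllPairs-∈ (p ∷ ps) (there i)   (here refl) = inj₂ (inj₂ (All.lookup p i))
AllPairs-∈ (p ∷ ps) (there i)   (there j)   = AllPairs-∈ ps i j

stars-All : ∀ {A : Set} {P : A → Set} {t} (c : Lab A t) → All P (labels c) → All (All P) (stars c)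
stars-All ∅ _ = [] ∷ []
stars-All (br a c s) (p ∷ ps) with stars-All c (++⁻ˡ (labels c) ps) | stars-All s (++⁻ʳ (labels c) ps)
... | hc ∷ bc | hs ∷ bs = (p ∷ hs) ∷ (p ∷ hc) ∷ AllP.++⁺ bc bs

-- Hanging a leaf or a leg on a vertex

fresh : ∀ {K xs} → All (_< K) xs → K ∉ xs
fresh b i = <-irrefl refl (All.lookup b i)

count-≡ : ∀ x xs → count x (x ∷ xs) ≡ suc (count x xs)
count-≡ x xs = cong length (filter-accept (x ≟_) {x} {xs} refl)

count-≢ : ∀ x {y} xs → x ≢ y → count x (y ∷ xs) ≡ count x xs
count-≢ x {y} xs n = cong length (filter-reject (x ≟_) {y} {xs} n)

count-fresh : ∀ {K xs} → All (_< K) xs → count K xs ≡ 0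
count-fresh {K} {xs} b = cong length (filter-none (K ≟_) (All.map (λ y<K e → <-irrefl (sym e) y<K) b))

balanced-one : ∀ {K xs} → All (_< K) xs → Balanced K 0 xs → Balanced (suc K) 0 (K ∷ xs)
balanced-one {K} {xs} b bal x x<K+1 with x ≟ K
... | yes refl rewrite count-≡ K xs | count-fresh b = s≤s z≤n , s≤s z≤n
... | no n rewrite count-≢ x xs n = bal x (≤∧≢⇒< (s≤s⁻¹ x<K+1) n)

-- The new class has size two, and 2 lies between `lo + 1` and `lo + 2` exactly when `lo ≤ 1`.
balanced-two : ∀ {K lo xs ys} → lo ≤ 1 → All (_< K) xs → Balanced K lo xs → ys ↭ K ∷ K ∷ xs →
               Balanced (suc K) lo ys
balanced-two {K} {lo} {xs} lo≤1 b bal p x x<K+1 rewrite count-↭ x p with x ≟ K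
... | yes refl rewrite count-≡ K (K ∷ xs) | count-≡ K xs | count-fresh b = s≤s lo≤1 , s≤s (s≤s z≤n)
... | no n rewrite count-≢ x (K ∷ xs) n | count-≢ x xs n = bal x (≤∧≢⇒< (s≤s⁻¹ x<K+1) n)

bounded-suc : ∀ {K xs} → All (_< K) xs → All (_< suc K) xs
bounded-suc = All.map m<n⇒m<1+n

bounded-two : ∀ {K xs ys} → All (_< K) xs → ys ↭ K ∷ K ∷ xs → All (_< suc K) ys
bounded-two b p = All-resp-↭ (↭-sym p) (n<1+n _ ∷ n<1+n _ ∷ bounded-suc b)

notIn⇒All≢ : ∀ {x : ℕ} {xs} → x ∉ xs → All (x ≢_) xs
notIn⇒All≢ n = All.tabulate λ i e → n (subst (_∈ _) (sym e) i)

-- Only the root and the new leaf see `K`. The root keeps an old colour, which the leaf lacks; this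
-- is why the root must have a child.
addLeaf-vdec : ∀ {K c s} (x : Lab ℕ (br c s)) → All (_< K) (labels x) → Vdec x → Vdec (br K ∅ x)
addLeaf-vdec {K} x@(br a c s) b v with stars-All x b
... | bh ∷ bb = vdec
  ((notIn⇒All≢ (fresh bh) ∷ All.head (Vdec.proper v)) ∷ ([] ∷ []) ∷ All.tail (Vdec.proper v))
  ( (differ (there (here refl)) (λ { (here e) → <-irrefl e (All.head b) })
     ∷ All.map (λ br → differ (here refl) (fresh br)) bb)
  ∷ All.map (λ br → differ (here refl) (fresh br)) bb
  ∷ AllPairs.tail (Vdec.distinct v))

addLeaf : ∀ {K c s} → Colourable K 0 (br c s) → Colourable (suc K) 0 (br ∅ (br c s))
addLeaf {K} (x , g) = br K ∅ x , record
  { bounded  = n<1+n K ∷ bounded-suc bounded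
  ; balanced = balanced-one bounded balanced
  ; isVdec   = v }
  where
  open Good g
  v : Vdec (br K ∅ x)
  v = addLeaf-vdec x bounded isVdec

-- Four stars contain `K`: the two ends of the recoloured edge, the middle of the leg and its leaf.
-- The far end has lost `α`, which by properness it had only once; where `α` does not separate two
-- of the four, a second old colour at an end of the edge does. So both ends need a further edge.
addLeg-vdec : ∀ {K α c s c' s'} (y : Lab ℕ (br c s)) (z : Lab ℕ (br c' s')) →
              All (_< K) (labels (br α y z)) → Vdec (br α y z) →
              Vdec (br K y (br α (br K ∅ ∅) z))
addLeg-vdec {K} {α} y@(br β _ _) z@(br δ _ _) b (vdec (u ∷ w ∷ us) ((d ∷ ds) ∷ (es ∷ ps)))
  with stars-All (br α y z) b
... | (α<K ∷ δ<K ∷ bz) ∷ (_ ∷ β<K ∷ by) ∷ bs = vdec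
  ( (((≢-sym (<⇒≢ α<K)) ∷ notIn⇒All≢ (fresh (δ<K ∷ bz))) ∷ u)
  ∷ (notIn⇒All≢ (fresh (β<K ∷ by)) ∷ AllPairs.tail w)
  ∷ AllP.++⁺ (++⁻ˡ (below y) us) (((<⇒≢ α<K ∷ []) ∷ [] ∷ []) ∷ ([] ∷ []) ∷ ++⁻ʳ (below y) us))
  -- The two stars of the leg are moved forward, so that all stars with `K` precede those without.
  (Distinct-≋ (↭⇒≋ (prep R (prep Y p)))
    (( differ {α} (there (here refl)) (λ { (here e) → <⇒≢ α<K e ; (there i) → α∉y i })
     ∷ differ {δ} (there (there (here refl)))
         (λ { (here e) → All.head (AllPairs.head u) (sym e) ; (there (here e)) → <⇒≢ δ<K e })
     ∷ differ {α} (there (here refl)) (λ { (here e) → <⇒≢ α<K e })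
     ∷ κ∉)
    ∷ (Differ-sym (differ {α} (here refl) (λ { (here e) → <⇒≢ α<K e ; (there i) → α∉y i }))
     ∷ differ {β} (there (here refl)) (λ { (here e) → <⇒≢ β<K e })
     ∷ κ∉)
    ∷ (differ {α} (here refl) (λ { (here e) → <⇒≢ α<K e })
     ∷ All.map (λ b → differ {K} (there (here refl)) (fresh b)) bs)
    ∷ κ∉
    ∷ ps))
  where
  R = K ∷ α ∷ heads z
  Y = K ∷ heads y
  Z = α ∷ K ∷ []
  L = K ∷ []
  α∉y : α ∉ heads y
  α∉y i = All.lookup (AllPairs.head w) i refl
  κ∉ : ∀ {xs} → All (Differ (K ∷ xs)) (below y ++ below z)
  κ∉ = All.map (λ b → differ {K} (here refl) (fresh b)) bs
  p : Z ∷ L ∷ below y ++ below z ↭ below y ++ Z ∷ L ∷ below z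
  p = shifts (Z ∷ L ∷ []) (below y)

addLeg : ∀ {K lo c s c' s'} → lo ≤ 1 → Colourable K lo (br (br c s) (br c' s')) →
         Colourable (suc K) lo (br (br c s) (br (br ∅ ∅) (br c' s')))
addLeg {K} lo≤1 (br α y z , g) = br K y (br α (br K ∅ ∅) z) , record
  { bounded  = bounded-two bounded p
  ; balanced = balanced-two lo≤1 bounded balanced p
  ; isVdec   = v }
  where
  open Good g
  v : Vdec (br K y (br α (br K ∅ ∅) z))
  v = addLeg-vdec y z bounded isVdec
  p : K ∷ labels y ++ (α ∷ K ∷ labels z) ↭ K ∷ K ∷ α ∷ labels y ++ labels z
  p = prep K (↭-trans (shifts (labels y) (α ∷ K ∷ [])) (swap α K ↭-refl))

-- Subdividing an edge

-- After hanging a leaf of colour κ on u, the star of u is the only other star containing κ, and it is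
-- big.  In this form the fact survives re-rooting, which forgets where u is.
OneOrBig : ℕ → List ℕ → Set
OneOrBig κ r = κ ∈ r → length r ≡ 1 ⊎ 3 ≤ length r

NotBothBig : ℕ → List ℕ → List ℕ → Set
NotBothBig κ r r' = κ ∈ r → κ ∈ r' → 3 ≤ length r → 3 ≤ length r' → ⊥

Isolated : ℕ → List (List ℕ) → Set
Isolated κ rs = All (OneOrBig κ) rs × AllPairs (NotBothBig κ) rs

Isolated-≋ : ∀ {κ rs rs'} → rs ≋ rs' → Isolated κ rs → Isolated κ rs'
Isolated-≋ {κ} p (o , n) =
    All-≋ (λ q h i → subst (λ l → l ≡ 1 ⊎ 3 ≤ l) (↭-length q) (h (∈-resp-↭ (↭-sym q) i))) p o
  , AllPairs-≋ (λ h i j x y → h j i y x)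
      (λ q h i j x y → h i (∈-resp-↭ (↭-sym q) j) x (subst (3 ≤_) (sym (↭-length q)) y)) p n

-- The root has two edges already, hence degree at least three with the new leaf.
addLeaf-isolated : ∀ {K c d s} (x : Lab ℕ (br c (br d s))) → All (_< K) (labels x) →
                   Isolated K (stars (br K ∅ x))
addLeaf-isolated {K} x@(br a c (br a' d s)) b with stars-All x b
... | bh ∷ bb =
    (λ _ → inj₂ (s≤s (s≤s (s≤s z≤n)))) ∷ (λ _ → inj₁ refl) ∷ All.map (λ br i → ⊥-elim (fresh br i)) bb
  , ((λ { _ _ _ (s≤s ()) }) ∷ All.map (λ br _ i → ⊥-elim (fresh br i)) bb)
  ∷ All.map (λ br _ i → ⊥-elim (fresh br i)) bb
  ∷ none bb
  where
  none : ∀ {rs} → All (All (_< K)) rs → AllPairs (NotBothBig K) rs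
  none []       = []
  none (p ∷ ps) = All.map (λ br _ i → ⊥-elim (fresh br i)) ps ∷ none ps

module _ {κ γ c s c' s'} (e : Lab ℕ (br c s)) (z : Lab ℕ (br c' s'))
         (v : Vdec (br γ e z)) (iso : Isolated κ (stars (br γ e z))) where

  private
    rest = below e ++ below z
    ze   = br γ e z

    big : ∀ {r} → r ∈ stars ze → κ ∈ r → 2 ≤ length r → 3 ≤ length r
    big m i 2≤ with All.lookup (proj₁ iso) m i
    ... | inj₁ q rewrite q = ⊥-elim (<-irrefl refl 2≤)
    ... | inj₂ 3≤ = 3≤

    two : ∀ (a : ℕ) {c s} (x : Lab ℕ (br c s)) → 2 ≤ length (a ∷ heads x)
    two _ (br _ _ _) = s≤s (s≤s z≤n)

    xy-not-both : κ ∈ γ ∷ heads z → κ ∈ γ ∷ heads e → ⊥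
    xy-not-both i j = All.head (AllPairs.head (proj₂ iso)) i j
      (big (here refl) i (two γ z)) (big (there (here refl)) j (two γ e))

  κ≢γ : κ ≢ γ
  κ≢γ q = xy-not-both (here q) (here q)

  heads-not-both : κ ∈ heads z → κ ∉ heads e
  heads-not-both i j = xy-not-both (there i) (there j)

  -- The new vertex has the set {γ, κ}, and by `Isolated` no other star containing `κ` has size two.
  -- The end keeping `γ` has an unchanged set, so only the end that trades `γ` for `κ` can clash,
  -- and only with a star containing `κ`.
  subdivide : κ ∉ heads e → (∀ {r} → r ∈ rest → κ ∈ r → Differ r (κ ∷ heads e)) →
              Vdec (br γ (br κ e ∅) z)
  subdivide κ∉e h = go v
    where
    toRest : ∀ {P : List ℕ → Set} → All P rest → All P ((below e ++ []) ++ below z)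
    toRest = subst (All _) (cong (_++ below z) (sym (++-identityʳ (below e))))
    dz : ∀ {r} → r ∈ stars ze → Unique r → Differ (γ ∷ κ ∷ []) r
    dz {r} m ur q with same-length (((λ q → κ≢γ (sym q)) ∷ []) ∷ [] ∷ []) ur q
    ... | q2 = <-irrefl q2 (big m (proj₁ q _ (there (here refl))) (≤-reflexive q2))
    y' : ∀ {r} → r ∈ rest → Dec (κ ∈ r) → Differ r (κ ∷ heads e)
    y' m (yes i) = h m i
    y' m (no n)  = Differ-sym (differ (here refl) n)
    go : Vdec ze → Vdec (br γ (br κ e ∅) z)
    go (vdec (u ∷ w ∷ us) ((d ∷ ds) ∷ (es ∷ ps))) = vdec
      ( u
      ∷ (((λ q → κ≢γ (sym q)) ∷ []) ∷ [] ∷ [])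
      ∷ (notIn⇒All≢ κ∉e ∷ AllPairs.tail w)
      ∷ subst (All Unique) (cong (_++ below z) (sym (++-identityʳ (below e)))) us)
      (( Differ-sym (dz (here refl) u)
       ∷ differ (here refl) γ∉
       ∷ toRest ds)
      ∷ (differ (here refl) γ∉ ∷ toRest (All.tabulate λ m → dz (there (there m)) (All.lookup us m)))
      ∷ toRest (All.tabulate λ {r} m → Differ-sym (y' m (κ ∈? r)))
      ∷ subst (AllPairs Differ) (cong (_++ below z) (sym (++-identityʳ (below e)))) ps)
      where
      γ∉ : γ ∉ κ ∷ heads e
      γ∉ (here q)  = κ≢γ (sym q)
      γ∉ (there i) = All.lookup (AllPairs.head w) i refl

  -- A star that clashes with `κ ∷ heads x` is too large to be that of a leaf, so `OneOrBig` makes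
  -- it big.
  big-rest : ∀ {r a b} (x : Lab ℕ (br a b)) → r ∈ rest → κ ∈ r → Unique (κ ∷ heads x) →
             Same r (κ ∷ heads x) → 3 ≤ length r
  big-rest {r} x m i u q = big (there (there m)) i
    (subst (2 ≤_) (sym (same-length ur u q)) (two κ x))
    where
    ur : Unique r
    ur = All.lookup (All.tail (All.tail (Vdec.proper v))) m

module _ {κ γ c s c' s'} (e : Lab ℕ (br c s)) (z : Lab ℕ (br c' s'))
         (v : Vdec (br γ e z)) (iso : Isolated κ (stars (br γ e z))) where

  private
    rest = below e ++ below z
    w : Vdec (br γ z e)
    w = Vdec-≋ (relabel-stars rot (br γ e z)) v
    iso' : Isolated κ (stars (br γ z e))
    iso' = Isolated-≋ (relabel-stars rot (br γ e z)) iso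
    flip : ∀ {r} → r ∈ below z ++ below e → r ∈ rest
    flip = ∈-resp-↭ (++-comm (below z) (below e))

    uniq : ∀ {a b} (x : Lab ℕ (br a b)) → Unique (γ ∷ heads x) → κ ∉ heads x → Unique (κ ∷ heads x)
    uniq x (_ ∷ u) n = notIn⇒All≢ n ∷ u

    unbig : ∀ {a b} (x : Lab ℕ (br a b)) → (γ ∷ heads x) ∈ stars (br γ e z) → κ ∈ heads x →
            ∀ {r} → (γ ∷ heads x) ≢ r → r ∈ stars (br γ e z) → κ ∈ r → 3 ≤ length r → ⊥
    unbig x@(br _ _ _) m i ne m' i' 3≤ with All.lookup (proj₁ iso) m (there i)
    ... | inj₁ ()
    ... | inj₂ 3≤' with AllPairs-∈ (proj₂ iso) m m'
    ... | inj₁ q = ne q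
    ... | inj₂ (inj₁ h) = h (there i) i' 3≤' 3≤
    ... | inj₂ (inj₂ h) = h i' (there i) 3≤ 3≤'

    same-swap : ∀ {a b xs ys} → a ∉ xs → a ∉ ys → Same (a ∷ xs) (a ∷ ys) → Same (b ∷ xs) (b ∷ ys)
    same-swap {a} {b} nx ny (f , g) = half nx f , half ny g
      where
      half : ∀ {xs ys} → a ∉ xs → (∀ x → x ∈ a ∷ xs → x ∈ a ∷ ys) → ∀ x → x ∈ b ∷ xs → x ∈ b ∷ ys
      half n h x (here q) = here q
      half n h x (there i) with h x (there i)
      ... | here refl = ⊥-elim (n i)
      ... | there j   = there j

  -- If `κ` is present at one end, that end has the big star with `κ`, and `κ` goes to the half away
  -- from it: a clashing star would be a second big one. If `κ` is at neither end, the first choice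
  -- is tried, and a clash makes the second choice work.
  subdivide-edge : Vdec (br γ (br κ e ∅) z) ⊎ Vdec (br γ (br κ z ∅) e)
  subdivide-edge = go v (κ ∈? heads z) (κ ∈? heads e)
    where
    go : Vdec (br γ e z) → Dec (κ ∈ heads z) → Dec (κ ∈ heads e) →
         Vdec (br γ (br κ e ∅) z) ⊎ Vdec (br γ (br κ z ∅) e)
    go (vdec (u ∷ w' ∷ us) ((d ∷ ds) ∷ _)) (yes i) _ =
      inj₁ (subdivide e z v iso ne λ m j q →
        unbig z (here refl) i (λ { refl → All.lookup ds m (↭⇒Same ↭-refl) }) (there (there m)) j
          (big-rest e z v iso e m j (uniq e w' ne) q))
      where
      ne = heads-not-both e z v iso i
    go (vdec (u ∷ w' ∷ us) ((d ∷ ds) ∷ (es ∷ _))) (no nz) (yes i) =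
      inj₂ (subdivide z e w iso' nz λ m j q →
        unbig e (there (here refl)) i (λ { refl → All.lookup es (flip m) (↭⇒Same ↭-refl) }) (there (there
            (flip m))) j
          (big-rest e z v iso z (flip m) j (uniq z u nz) q))
    go (vdec (u ∷ w' ∷ us) ((d ∷ ds) ∷ _)) (no nz) (no ne)
      with All.all? (λ r → κ ∈? r →-dec ¬? (same? r (κ ∷ heads e))) rest
    ... | yes h = inj₁ (subdivide e z v iso ne (All.lookup h))
    ... | no ¬h with find (¬All⇒Any¬ (λ r → κ ∈? r →-dec ¬? (same? r (κ ∷ heads e))) rest ¬h)
    ... | r , m , ¬hr = inj₂ (subdivide z e w iso' nz second)
      where
      κ∈r : κ ∈ r
      κ∈r = decidable-stable (κ ∈? r) (λ n → ¬hr (λ i → ⊥-elim (n i)))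
      same : Same r (κ ∷ heads e)
      same = decidable-stable (same? r (κ ∷ heads e)) (λ n → ¬hr (λ _ → n))
      -- Both clashing stars would be big and contain `κ`, so they coincide, and the two ends had
      -- equal sets before the subdivision.
      second : ∀ {r'} → r' ∈ below z ++ below e → κ ∈ r' → Differ r' (κ ∷ heads z)
      second {r'} m' i' q with AllPairs-∈ (AllPairs.tail (AllPairs.tail (proj₂ iso))) m (flip m')
      ... | inj₁ refl = d (Same-sym (same-swap ne nz (Same-trans (Same-sym same) q)))
      ... | inj₂ h = both h
        where
        b  = big-rest e z v iso e m κ∈r (uniq e w' ne) same
        b' = big-rest e z v iso z (flip m') i' (uniq z u nz) q
        both : _ → ⊥
        both (inj₁ h) = h κ∈r i' b b'
        both (inj₂ h) = h i' κ∈r b' b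

addLeaf-subdivide : ∀ {K lo c d s e f e' f'} → lo ≤ 1 →
  br ∅ (br c (br d s)) ≈ br (br e f) (br e' f') → Colourable K lo (br c (br d s)) →
  Colourable (suc K) lo (br (br (br e f) ∅) (br e' f'))
addLeaf-subdivide {K} {lo} lo≤1 p (x , g)
  with relabel p (br K ∅ x) in eq | relabel-stars p (br K ∅ x) | relabel-labels p (br K ∅ x)
... | br γ y z | σ | λs with subdivide-edge y z v (Isolated-≋ σ (addLeaf-isolated x (Good.bounded g)))
  where
  v₀ = addLeaf-vdec x (Good.bounded g) (Good.isVdec g)
  v : Vdec (br γ y z)
  v = Vdec-≋ σ v₀
... | inj₁ v = br γ (br K y ∅) z , record
  { bounded = bounded-two (Good.bounded g) q
  ; balanced = balanced-two lo≤1 (Good.bounded g) (Good.balanced g) q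
  ; isVdec   = v }
  where
  q : γ ∷ (K ∷ labels y ++ []) ++ labels z ↭ K ∷ K ∷ labels x
  q = ↭-trans (swap γ K (↭.↭-reflexive (cong (_++ labels z) (++-identityʳ (labels y))))) (prep K (↭-sym λs))
-- Here `K` lies on the half at the other end; the unrooted tree is the same.
... | inj₂ v = Colourable-≈ (≈-trans rot (≈-trans (front (br _ ∅)) rot)) (br γ (br K z ∅) y , record
  { bounded = bounded-two (Good.bounded g) q
  ; balanced = balanced-two lo≤1 (Good.bounded g) (Good.balanced g) q
  ; isVdec   = v })
  where
  q : γ ∷ (K ∷ labels z ++ []) ++ labels y ↭ K ∷ K ∷ labels x
  q = ↭-trans (swap γ K (↭-trans (↭.↭-reflexive (cong (_++ labels y) (++-identityʳ (labels z)))) (++-comm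
      (labels z) (labels y)))) (prep K (↭-sym λs))

-- Finding a reduction

width : Shape → ℕ
width ∅        = 0
width (br _ s) = suc (width s)

data Nonempty : Shape → Set where
  nonempty : ∀ {c s} → Nonempty (br c s)

data Leaf : Shape → Set where
  leaf : Leaf ∅

-- Properties of the forest below a vertex: a leg is a child of degree 2 followed by a leaf, a thread
-- vertex has degree 2 and a child that is not a leaf.
data Leg : Shape → Set where
  leg : Leg (br ∅ ∅)

data Thread : Shape → Set where
  thread : ∀ {c s} → Thread (br (br c s) ∅)

data Child (P : Shape → Set) : Shape → Set where
  here  : ∀ {c s} → P c → Child P (br c s)
  there : ∀ {c s} → Child P s → Child P (br c s)

child? : ∀ {P} → (∀ c → Dec (P c)) → ∀ s → Dec (Child P s)
child? P? ∅ = no λ ()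
child? P? (br c s) with P? c | child? P? s
... | yes p | _     = yes (here p)
... | no ¬p | yes q = yes (there q)
... | no ¬p | no ¬q = no λ { (here p) → ¬p p ; (there q) → ¬q q }

leaf? : ∀ c → Dec (Leaf c)
leaf? ∅        = yes leaf
leaf? (br _ _) = no λ ()

leg? : ∀ c → Dec (Leg c)
leg? ∅               = no λ ()
leg? (br ∅ ∅)        = yes leg
leg? (br (br _ _) _) = no λ ()
leg? (br ∅ (br _ _)) = no λ ()

nonempty? : ∀ c → Dec (Nonempty c)
nonempty? ∅        = no λ ()
nonempty? (br _ _) = yes nonempty

thread? : ∀ c → Dec (Thread c)
thread? ∅                      = no λ ()
thread? (br ∅ _)               = no λ ()
thread? (br (br _ _) ∅)        = yes thread
thread? (br (br _ _) (br _ _)) = no λ ()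

-- With the edge to the parent this is degree at least three.
Branching : (Shape → Set) → Shape → Set
Branching P c = 2 ≤ width c × Child P c

branching? : ∀ {P} → (∀ c → Dec (P c)) → ∀ s → Dec (Branching P s)
branching? P? s = (2 ≤? width s) ×-dec child? P? s

split : ∀ {P s} → Child P s → ∃ λ s₁ → ∃ λ c → ∃ λ s₂ → s ≡ s₁ ⊕ br c s₂ × P c
split (here p) = ∅ , _ , _ , refl , p
split (there {d} q) with split q
... | s₁ , c , s₂ , refl , p = br d s₁ , c , s₂ , refl , p

width-front : ∀ s c s' → width (s ⊕ br c s') ≡ suc (width (s ⊕ s'))
width-front ∅ c s' = refl
width-front (br _ s) c s' = cong suc (width-front s c s')

⊕-assoc : ∀ s t u → (s ⊕ t) ⊕ u ≡ s ⊕ (t ⊕ u)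
⊕-assoc ∅ t u = refl
⊕-assoc (br c s) t u = cong (br c) (⊕-assoc s t u)

Everywhere : (Shape → Set) → Shape → Set
Everywhere P ∅        = ⊤
Everywhere P (br c s) = P c × Everywhere P c × Everywhere P s

-- A vertex of t other than the root in the tree s₀ ⊕ t, seen from its edge to the parent; replace
-- substitutes another tree for the subtree of that vertex.
record Located (P : Shape → Set) (s₀ t : Shape) : Set where
  constructor located
  field
    {child here₁ here₂} : Shape
    holds   : P child
    at      : s₀ ⊕ t ≈ br child (br here₁ here₂)
    replace : ∀ c → ∃ λ t' → s₀ ⊕ t' ≈ br c (br here₁ here₂) × width t' ≡ width t

-- `br a b` is the part of the tree outside the current forest, seen from its vertex. It is never
-- `∅`, so the parent of the vertex found is not a leaf, and the edge between them is inner as soon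
-- as that vertex has a child.
locate : ∀ {P} → (∀ c → Dec (P c)) → ∀ a b t → Everywhere (¬_ ∘ P) t ⊎ Located P (br a b) t
locate P? a b ∅ = inj₁ tt
locate P? a b (br c s) with P? c
... | yes p = inj₂ (located p (front (br a b)) λ c' → br c' s , front (br a b) , refl)
... | no ¬p with locate P? (br a b ⊕ s) ∅ c
... | inj₂ (located p at rep) = inj₂ (located p (≈-trans (≈-trans (front (br a b)) rot) at) λ c' →
        let t' , q , _ = rep c' in br t' s , ≈-trans (≈-trans (front (br a b)) rot) q , refl)
... | inj₁ ec with locate P? a (b ⊕ br c ∅) s
... | inj₁ es = inj₁ (¬p , ec , es)
... | inj₂ (located p at rep) = inj₂ (located p (subst (λ x → br a x ≈ _) (⊕-assoc b (br c ∅) s) at) λ c' →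
        let t' , q , w = rep c' in br c t' , subst (λ x → br a x ≈ _) (⊕-assoc b (br c ∅) t') q , cong suc w)

leafFirst : ∀ c s → ∃ λ c' → br c s ≈ br ∅ c'
leafFirst ∅        s = s , ≈-refl
leafFirst (br d e) s with leafFirst d (br s e)
... | c' , p = c' , ≈-trans rot (≈-trans (front (br s ∅)) p)

module _ where
  open ≤-Reasoning
  open +-*-Solver

  through : ∀ k {l n} {P : Set} → k * l ≤ suc n × P →
            k * (l + 0) ≤ suc (suc (n + 0)) × (2 ≤ l + 0 → k * (l + 0) ≤ suc (n + 0))
  through k {l} {n} (p , _) rewrite +-identityʳ l | +-identityʳ n = m≤n⇒m≤1+n p , λ _ → p

  -- Every leaf hangs on a vertex of degree two, and the two edges there belong to no other leaf.
  -- With two or more leaves below a vertex, the edge to its parent is not among these, which the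
  -- second half of `leafless-node` records.
  leafless-sum : ∀ s → ¬ Child Leaf s → Everywhere (¬_ ∘ Branching Leaf) s → 2 * leaves s ≤ size s
  leafless-node : ∀ s → Nonempty s → ¬ Branching Leaf s → Everywhere (¬_ ∘ Branching Leaf) s →
                  2 * leaves s ≤ suc (size s) × (2 ≤ leaves s → 2 * leaves s ≤ size s)

  leafless-sum ∅ n e = z≤n
  leafless-sum (br ∅ s) n e = ⊥-elim (n (here leaf))
  leafless-sum (br c@(br _ _) s) n (¬b , ec , es) = begin
    2 * (leaves c + leaves s)       ≡⟨ *-distribˡ-+ 2 (leaves c) (leaves s) ⟩
    2 * leaves c + 2 * leaves s     ≤⟨ +-mono-≤ (proj₁ (leafless-node c nonempty ¬b ec)) (leafless-sum s
        (n ∘ there) es) ⟩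
    suc (size c) + size s           ∎

  leafless-node (br ∅ ∅) _ ¬b e = s≤s (s≤s z≤n) , λ { (s≤s ()) }
  leafless-node (br c@(br _ _) ∅) _ ¬b (¬b' , e , _) = through 2 (leafless-node c nonempty ¬b' e)
  leafless-node (br c s@(br _ _)) _ ¬b e =
    let p = leafless-sum (br c s) (λ l → ¬b (s≤s (s≤s z≤n) , l)) e in m≤n⇒m≤1+n p , λ _ → p

  unless-leg : ∀ c {P : Set} → (¬ Leg c → 3 * leaves c ≤ suc (size c) × P) →
               3 * (leaves c + 0) ≤ suc (suc (size c + 0)) × (2 ≤ leaves c + 0 → 3 * (leaves c + 0) ≤ suc
                   (size c + 0))
  unless-leg c f with leg? c
  ... | yes leg = ≤-refl , λ { (s≤s ()) }
  ... | no ¬l   = through 3 (f ¬l)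

  -- Now each leaf ends a path of three edges of its own: the two vertices above it have degree two,
  -- as otherwise a leaf or a leg would hang on a branching vertex.
  tall-sum : ∀ s → ¬ Child Leaf s → ¬ Child Leg s →
             Everywhere (¬_ ∘ Branching Leaf) s → Everywhere (¬_ ∘ Branching Leg) s → 3 * leaves s ≤ size s
  tall-node : ∀ s → Nonempty s → ¬ Leg s → ¬ Branching Leaf s → ¬ Branching Leg s →
              Everywhere (¬_ ∘ Branching Leaf) s → Everywhere (¬_ ∘ Branching Leg) s →
              3 * leaves s ≤ suc (size s) × (2 ≤ leaves s → 3 * leaves s ≤ size s)
  tall-sum ∅ n n' e e' = z≤n
  tall-sum (br ∅ s) n n' e e' = ⊥-elim (n (here leaf))
  tall-sum (br c@(br _ _) s) n n' (¬b , ec , es) (¬b' , ec' , es') = begin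
    3 * (leaves c + leaves s)       ≡⟨ *-distribˡ-+ 3 (leaves c) (leaves s) ⟩
    3 * leaves c + 3 * leaves s     ≤⟨ +-mono-≤ (proj₁ (tall-node c nonempty (n' ∘ here) ¬b ¬b' ec ec'))
        (tall-sum s (n ∘ there) (n' ∘ there) es es') ⟩
    suc (size c) + size s           ∎
  tall-node (br ∅ ∅) _ ¬l = ⊥-elim (¬l leg)
  tall-node (br c s@(br _ _)) _ ¬l ¬b ¬b' e e' =
    let p = tall-sum (br c s) (λ l → ¬b (s≤s (s≤s z≤n) , l)) (λ l → ¬b' (s≤s (s≤s z≤n) , l)) e e'
    in m≤n⇒m≤1+n p , λ _ → p
  tall-node (br c@(br _ _) ∅) _ ¬l ¬b ¬b' (¬a , e , _) (¬a' , e' , _) =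
    unless-leg c (λ ¬l' → tall-node c nonempty ¬l' ¬a ¬a' e e')

  -- No vertex below has degree two: it would be a thread, or a leg whose parent is the root, a
  -- thread or a branching vertex. When all inner vertices have at least two children, there are
  -- fewer than twice as many edges as leaves.
  bushy-sum : ∀ s → ¬ Child Leg s → Everywhere (¬_ ∘ Thread) s → Everywhere (¬_ ∘ Branching Leg) s →
              size s + width s ≤ 2 * leaves s
  bushy-node : ∀ c → ¬ Leg c → ¬ Thread c → ¬ Branching Leg c → Everywhere (¬_ ∘ Thread) c → Everywhere
      (¬_ ∘ Branching Leg) c →
               2 + size c ≤ 2 * pleaves c
  bushy-sum ∅ n e e' = z≤n
  bushy-sum (br c s) n (¬t , ec , es) (¬b , ec' , es') = begin
    suc (size c + size s) + suc (width s) ≡⟨ solve 3 (λ a b c → con 1 :+ (a :+ b) :+ (con 1 :+ c) :=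
        (con 2 :+ a) :+ (b :+ c)) refl (size c) (size s) (width s) ⟩
    (2 + size c) + (size s + width s)     ≤⟨ +-mono-≤ (bushy-node c (n ∘ here) ¬t ¬b ec ec') (bushy-sum s
        (n ∘ there) es es') ⟩
    2 * pleaves c + 2 * leaves s          ≡⟨ *-distribˡ-+ 2 (pleaves c) (leaves s) ⟨
    2 * (pleaves c + leaves s)            ∎
  bushy-node ∅ _ _ _ _ _ = ≤-refl
  bushy-node (br ∅ ∅) ¬l _ _ _ _ = ⊥-elim (¬l leg)
  bushy-node (br (br _ _) ∅) _ ¬t _ _ _ = ⊥-elim (¬t thread)
  bushy-node c@(br x s@(br y z)) _ _ ¬b e e' = begin
    2 + size c        ≡⟨ +-comm 2 (size c) ⟩
    size c + 2        ≤⟨ +-monoʳ-≤ (size c) (s≤s (s≤s z≤n)) ⟩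
    size c + width c  ≤⟨ bushy-sum c (λ l → ¬b (s≤s (s≤s z≤n) , l)) e e' ⟩
    2 * leaves c      ∎

  only-leaves : ∀ s → ¬ Child Nonempty s → size s ≡ leaves s
  only-leaves ∅ n = refl
  only-leaves (br ∅ s) n = cong suc (only-leaves s (n ∘ there))
  only-leaves (br (br _ _) s) n = ⊥-elim (n (here nonempty))

-- The twig is a leaf at a vertex of degree at least 3.
HasTwig : Shape → Set
HasTwig t = ∃ λ c → t ≈ br ∅ c × 2 ≤ width c

-- The tree is seen from a leaf with a neighbour of degree two; the conditions concern what lies
-- beyond that neighbour.
Twigless : Shape → Set
Twigless t = ∃ λ c → ∃ λ s → t ≈ br ∅ (br (br c s) ∅) ×
  ¬ Branching Leaf (br c s) × Everywhere (¬_ ∘ Branching Leaf) (br c s)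

twig? : ∀ t → 3 ≤ nleaves t → HasTwig t ⊎ Twigless t
twig? (br x y) k≥3 with leafFirst x y
... | ∅ , p = ⊥-elim (<-irrefl refl (subst (3 ≤_) (nleaves-≈ p) k≥3))
... | br ∅ ∅ , p = ⊥-elim (<-irrefl refl (subst (3 ≤_) (nleaves-≈ p) k≥3))
... | br c (br d s) , p = inj₁ (_ , p , s≤s (s≤s z≤n))
... | br (br c s) ∅ , p with locate (branching? leaf?) ∅ ∅ (br (br c s) ∅)
... | inj₁ (¬b , e , _) = inj₂ (c , s , p , ¬b , e)
... | inj₂ (located (w , ch) at _) with split ch
... | s₁ , .∅ , s₂ , refl , leaf = inj₁ (_ , ≈-trans p (≈-trans at (≈-trans rot (front (br _ s₁)))) ,
        subst (2 ≤_) (width-front s₁ ∅ s₂) w)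

module _ where
  open ≤-Reasoning
  -- If no leaf sits at a branching vertex, each of the `k` leaves, the one at the root included,
  -- owns two edges.
  twig : ∀ t → 3 ≤ nleaves t → size t < 2 * nleaves t → HasTwig t
  twig t k≥3 h with twig? t k≥3
  ... | inj₁ tw = tw
  ... | inj₂ (c , s , p , ¬b , e) = ⊥-elim (<-irrefl refl (begin-strict
    size t                        <⟨ h ⟩
    2 * nleaves t                 ≡⟨ cong (2 *_) k ⟩
    2 * (1 + leaves d)            ≡⟨ *-distribˡ-+ 2 1 (leaves d) ⟩
    2 + 2 * leaves d              ≤⟨ s≤s (s≤s (proj₂ (leafless-node (br c s) nonempty ¬b e) (s≤s⁻¹ (subst
        (3 ≤_) k k≥3)))) ⟩
    2 + size d                    ≡⟨ trans (size-≈ p) (cong (2 +_) (+-identityʳ (size d))) ⟨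
    size t                        ∎))
    where
    d = br c s
    k : nleaves t ≡ 1 + leaves d
    k = trans (nleaves-≈ p) (cong suc (+-identityʳ (leaves d)))

nleaves-wide : ∀ {t} → 2 ≤ width t → pleaves t ≡ nleaves t
nleaves-wide {br _ (br _ _)} _ = refl
nleaves-wide {br _ ∅} (s≤s ())

-- One leaf and one inner edge disappear, so m - k is kept.
record Reduction (t : Shape) : Set where
  field
    smaller   : Shape
    leaves-   : nleaves t ≡ suc (nleaves smaller)
    size-     : size t ≡ 2 + size smaller
    colouring : ∀ {K lo} → lo ≤ 1 → Colourable K lo smaller → Colourable (suc K) lo t

leg-reduction : ∀ {t c s c' s'} → t ≈ br (br c s) (br (br ∅ ∅) (br c' s')) → Reduction t
leg-reduction {c = c} {s} {c'} {s'} p = record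
  { smaller   = br (br c s) (br c' s')
  ; leaves-   = trans (nleaves-≈ p) (+-suc (leaves (br c s)) _)
  ; size-     = trans (size-≈ p) (cong suc (trans (+-suc (size (br c s)) _) (cong suc (+-suc (size
      (br c s)) _))))
  ; colouring = λ lo≤1 col → Colourable-≈ (≈-sym p) (addLeg lo≤1 col) }

-- The edge to the parent serves as the inner edge to be recoloured.
branching-leg-reduction : ∀ {t c c' s'} → t ≈ br c (br c' s') → Branching Leg c → Reduction t
branching-leg-reduction {t} {c' = c'} {s'} p (w , ch) with split ch
... | s₁ , _ , s₂ , refl , leg with s₁ ⊕ s₂ | width-front s₁ (br ∅ ∅) s₂ | front (br (br c' s') s₁) {br ∅ ∅} {s₂}
...   | ∅ | q | _ = ⊥-elim (<-irrefl (sym q) w)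
...   | br u v | _ | f = leg-reduction (≈-trans p (≈-trans rot (≈-trans f (front (br (br ∅ ∅) ∅)))))

-- Smoothing the thread and cutting the leaf off leaves `c₁`, which has the width of `c`: the root
-- keeps two edges and its star is big once the leaf returns.
thread-reduction : ∀ {t c} → t ≈ br ∅ c → 2 ≤ width c → Located Thread (br ∅ ∅) c → Reduction t
thread-reduction {t} {c} p w (located {here₁ = h₁} {h₂} (thread {e} {f}) at rep) with rep (br e f)
... | c₁ , q , w₁ = record
  { smaller   = c₁
  ; leaves-   = trans (nleaves-≈ (≈-trans p at)) (trans (cong (_+ leaves (br h₁ h₂)) (+-identityʳ (leaves
      (br e f)))) (trans (sym (nleaves-≈ q)) (cong suc (nleaves-wide w₂))))
  ; size-     = trans (size-≈ (≈-trans p at)) (cong suc (trans (cong (λ x → suc x + size (br h₁ h₂))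
      (+-identityʳ (size (br e f)))) (sym (size-≈ q))))
  ; colouring = λ lo≤1 col → Colourable-≈ (≈-sym (≈-trans p at)) (go c₁ w₂ q lo≤1 col) }
  where
  w₂ = subst (2 ≤_) (sym w₁) w
  go : ∀ {K lo} c₁ → 2 ≤ width c₁ → br ∅ c₁ ≈ br (br e f) (br h₁ h₂) → lo ≤ 1 →
       Colourable K lo c₁ → Colourable (suc K) lo (br (br (br e f) ∅) (br h₁ h₂))
  go (br _ (br _ _)) _ q lo≤1 col = addLeaf-subdivide lo≤1 q col
  go (br _ ∅) (s≤s ())

module _ where
  open ≤-Reasoning
  open +-*-Solver

  -- Since m ≥ k forces vertices of degree two, and threads and branching legs below would do, what
  -- remains is a leg at the root, to be paired with another inner edge there.
  twig-reduction : ∀ {t c} → 3 ≤ nleaves t → 2 * nleaves t ≤ size t → t ≈ br ∅ c → 2 ≤ width c → Reduction t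
  twig-reduction {t} {c} k≥3 h p w with locate thread? ∅ ∅ c
  ... | inj₂ l = thread-reduction p w l
  ... | inj₁ nt with locate (branching? leg?) ∅ ∅ c
  ... | inj₂ (located b at _) = branching-leg-reduction (≈-trans p at) b
  ... | inj₁ nb with child? leg? c
  ... | no nl = ⊥-elim (<-irrefl refl (begin-strict
    size t                  ≡⟨ size-≈ p ⟩
    1 + size c              <⟨ s≤s (s≤s (m≤m+n (size c) (width c))) ⟩
    2 + (size c + width c)  ≤⟨ s≤s (s≤s (bushy-sum c nl nt nb)) ⟩
    2 + 2 * leaves c        ≡⟨ *-distribˡ-+ 2 1 (leaves c) ⟨
    2 * (1 + leaves c)      ≡⟨ cong (2 *_) (trans (nleaves-≈ p) (cong suc (pleaves-wide w))) ⟨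
    2 * nleaves t           ≤⟨ h ⟩
    size t                  ∎))
    where
    pleaves-wide : ∀ {c} → 2 ≤ width c → pleaves c ≡ leaves c
    pleaves-wide {br _ _} _ = refl
  ... | yes ch with split ch
  ... | s₁ , _ , s₂ , refl , leg with child? nonempty? (s₁ ⊕ s₂) | front (br ∅ s₁) {br ∅ ∅} {s₂}
  -- The first edge of the leg would be the only inner edge, contrary to m ≥ k.
  ... | no nn | q = ⊥-elim (<-irrefl refl (begin-strict
    size t                  ≡⟨ size-≈ (≈-trans p q) ⟩
    3 + size r              ≡⟨ cong (3 +_) (only-leaves r nn) ⟩
    3 + leaves r            <⟨ s≤s (s≤s (s≤s (s≤s (m≤m+n (leaves r) (leaves r + 0))))) ⟩
    4 + 2 * leaves r        ≡⟨ *-distribˡ-+ 2 2 (leaves r) ⟨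
    2 * (2 + leaves r)      ≡⟨ cong (2 *_) (nleaves-≈ (≈-trans p q)) ⟨
    2 * nleaves t           ≤⟨ h ⟩
    size t                  ∎))
    where
    r = s₁ ⊕ s₂
  ... | yes ch' | q with s₁ ⊕ s₂ | split ch'
  ... | _ | r₁ , _ , r₂ , refl , nonempty =
    leg-reduction (≈-trans p (≈-trans q (front (br (br ∅ ∅) (br ∅ r₁)))))

  -- Three private edges per leaf would give size ≥ 3 k, but size ≤ 2 k + 2 < 3 k for k ≥ 3. Hence
  -- some branching vertex has a leg.
  twigless-reduction : ∀ {t} → 3 ≤ nleaves t → size t ≤ 2 * nleaves t + 2 → Twigless t → Reduction t
  twigless-reduction {t} k≥3 h (c , s , p , ¬b , e) with locate (branching? leg?) ∅ ∅ (br (br c s) ∅)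
  ... | inj₂ (located b at _) = branching-leg-reduction (≈-trans p at) b
  twigless-reduction k≥3 h (∅ , br _ _ , p , ¬b , e) | inj₁ _ = ⊥-elim (¬b (s≤s (s≤s z≤n) , here leaf))
  -- The leaf used as viewpoint and its neighbour themselves form the leg.
  twigless-reduction k≥3 h (br _ _ , br _ _ , p , ¬b , e) | inj₁ _ =
    leg-reduction (≈-trans p (≈-trans (front (br ∅ ∅)) (≈-trans rot (front (br (br ∅ ∅) ∅)))))
  twigless-reduction k≥3 h (∅ , ∅ , p , ¬b , e) | inj₁ _ =
    ⊥-elim (<-irrefl refl (≤-trans (subst (3 ≤_) (nleaves-≈ p) k≥3) ≤-refl))
  twigless-reduction {t} k≥3 h (c@(br x y) , ∅ , p , ¬b , (¬b' , e , _)) | inj₁ (_ , (¬l , e' , _) , _) with leg? c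
  ... | yes leg = ⊥-elim (<-irrefl refl (subst (3 ≤_) (nleaves-≈ p) k≥3))
  ... | no nl = ⊥-elim (<-irrefl refl (begin-strict
    size t                       ≤⟨ h ⟩
    2 * nleaves t + 2            <⟨ +-monoʳ-< (2 * nleaves t) k≥3 ⟩
    2 * nleaves t + nleaves t    ≡⟨ solve 1 (λ k → con 2 :* k :+ k := con 3 :* k) refl (nleaves t) ⟩
    3 * nleaves t                ≡⟨ cong (3 *_) k ⟩
    3 * (1 + leaves c)           ≡⟨ *-distribˡ-+ 3 1 (leaves c) ⟩
    3 + 3 * leaves c             ≤⟨ +-monoʳ-≤ 3 (proj₂ (tall-node c nonempty nl ¬b' ¬l e e') (s≤s⁻¹ (subst
        (3 ≤_) k k≥3))) ⟩
    3 + size c                   ≡⟨ trans (size-≈ p) (cong (2 +_) (trans (+-identityʳ _) (cong suc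
        (+-identityʳ (size c))))) ⟨
    size t                       ∎))
    where
    k : nleaves t ≡ 1 + leaves c
    k = trans (nleaves-≈ p) (cong suc (trans (+-identityʳ _) (+-identityʳ (leaves c))))

reduction : ∀ t → 3 ≤ nleaves t → 2 * nleaves t ≤ size t → size t ≤ 2 * nleaves t + 2 → Reduction t
reduction t k≥3 l u with twig? t k≥3
... | inj₁ (c , p , w) = twig-reduction k≥3 l p w
... | inj₂ tl          = twigless-reduction k≥3 u tl

-- Exhaustive search for small trees

-- Stars are compared by a code invariant under permutations; its injectivity is not needed.
code : List ℕ → ℕ
code []       = 0
code (x ∷ xs) = 2 ^ x + code xs

Checked : ∀ {t} → ℕ → ℕ → Lab ℕ t → Set
Checked K lo c = All (_< K) (labels c)
  × All (λ x → suc lo ≤ count x (labels c) × count x (labels c) ≤ 2 + lo) (upTo K)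
  × All Unique (stars c)
  × Unique (map code (stars c))

checked? : ∀ {t} K lo (c : Lab ℕ t) → Dec (Checked K lo c)
checked? K lo c = All.all? (_<? K) (labels c)
  ×-dec All.all? (λ x → (suc lo ≤? count x (labels c)) ×-dec (count x (labels c) ≤? 2 + lo)) (upTo K)
  ×-dec All.all? unique? (stars c)
  ×-dec unique? (map code (stars c))

_∈ᵇ_ : ℕ → List ℕ → Bool
x ∈ᵇ []       = false
x ∈ᵇ (y ∷ ys) = (x ≡ᵇ y) ∨ (x ∈ᵇ ys)

-- Pendant edges get the colours 0, 1, 2, … in order of appearance; once and twice list the colours
-- used on that many inner edges, spare bounds the length of twice.
record State : Set where
  constructor state
  field
    nextLeaf : ℕ
    spare : ℕ
    once : List ℕ
    twice : List ℕ
    seen : List ℕ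

module Solve (K : ℕ) {R : Set} where
  -- The continuation colours the rest of the tree, so a dead end there falls back to the choices
  -- made here.
  solve : (t : Shape) → List ℕ → State → (Lab ℕ t → State → Maybe R) → Maybe R
  try   : (c s : Shape) → ℕ → List ℕ → State → (Lab ℕ (br c s) → State → Maybe R) → Maybe R
  solve ∅ st (state l d u w se) k =
    if code st ∈ᵇ se then nothing else k ∅ (state l d u w (code st ∷ se))
  -- The star of a leaf need not be recorded: pendant colours never repeat, and every other star is
  -- larger.
  solve (br ∅ s) st (state l d u w se) k =
    if l ∈ᵇ st then nothing
    else solve s (l ∷ st) (state (suc l) d u w se) (λ s' σ → k (br l ∅ s') σ)
  solve (br c@(br _ _) s) st σ k = try c s K st σ k
  try c s zero st σ k = nothing
  try c s (suc x) st σ@(state l d u w se) k =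
    (if (x ∈ᵇ st) ∨ (x ∈ᵇ w) then nothing
     else if x ∈ᵇ u
       then (if d ≡ᵇ 0 then nothing else next (state l (pred d) u (x ∷ w) se))
       else next (state l d (x ∷ u) w se))
    <∣> try c s x st σ k
    where
    next : State → Maybe R
    next σ = solve s (x ∷ st) σ λ s' σ' → solve c (x ∷ []) σ' λ c' σ'' → k (br x c' s') σ''

solution : ℕ → ℕ → (t : Shape) → Maybe (Lab ℕ (br t ∅))
solution K D t = Solve.solve K t (0 ∷ []) (state 1 D [] [] []) λ c _ → just (br 0 c ∅)

-- A labelling that is found gets checked anew, so nothing has to be proved about the search.
solved : ℕ → ℕ → ℕ → Shape → Bool
solved K lo D t with solution K D t
... | nothing = false
... | just c  = does (checked? K lo c)

-- The first argument is fuel; it has to exceed the number of edges.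
shapes plantedShapes : (fuel edges leaves : ℕ) → List Shape
shapes zero    _       _       = []
shapes (suc f) zero    zero    = ∅ ∷ []
shapes (suc f) zero    (suc _) = []
shapes (suc f) (suc e) l       = concatMap (λ i → concatMap (λ j →
  cartesianProductWith br (plantedShapes f i j) (shapes f (e ∸ i) (l ∸ j))) (upTo (suc l))) (upTo (suc e))
plantedShapes f zero    (suc zero) = ∅ ∷ []
plantedShapes f zero    _          = []
plantedShapes f (suc i) j          = shapes f (suc i) j

allᵇ : {X : Set} → (X → Bool) → List X → Bool
allᵇ p []       = true
allᵇ p (x ∷ xs) = p x ∧ allᵇ p xs

code-↭ : ∀ {xs ys} → xs ↭ ys → code xs ≡ code ys
code-↭ ↭.refl                   = refl
code-↭ (↭.prep x p)             = cong (2 ^ x +_) (code-↭ p)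
code-↭ (↭.swap {xs} {ys} x y p) rewrite code-↭ p = +-exchange (2 ^ x) (2 ^ y) (code ys)
code-↭ (↭.trans p q)            = trans (code-↭ p) (code-↭ q)

differ-code : ∀ {xs} → All Unique xs → AllPairs (λ x y → code x ≢ code y) xs → AllPairs Differ xs
differ-code [] [] = []
differ-code (u ∷ us) (d ∷ ds) = All.zipWith
  (λ (v , n) e → n (code-↭ (same-↭ u v e))) (us , d)
  ∷ differ-code us ds

checked-good : ∀ {t K lo} {c : Lab ℕ t} → Checked K lo c → Good K lo c
checked-good (b , s , u , d) = record
  { bounded  = b
  ; balanced = λ x x<K → All.lookup s (∈-upTo⁺ x<K)
  ; isVdec   = vdec u (differ-code u (APP.map⁻ d))
  }

solved-sound : ∀ K lo D t → solved K lo D t ≡ true → Colourable K lo (br t ∅)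
solved-sound K lo D t h with solution K D t | h
... | just c | h' = c , checked-good (does-true (checked? K lo c) h')
  where
  does-true : ∀ {P : Set} (p? : Dec P) → does p? ≡ true → P
  does-true (yes p) _ = p

shapes-complete : ∀ f t → size t < f → t ∈ shapes f (size t) (leaves t)
shapes-complete (suc f) ∅ _ = here refl
shapes-complete (suc f) (br c s) (s≤s h) =
  ∈-concatMap⁺ _ (lose (∈-upTo⁺ (s≤s (m≤m+n (size c) (size s))))
    (∈-concatMap⁺ _ (lose (∈-upTo⁺ (s≤s (m≤m+n (pleaves c) (leaves s))))
      (∈-cartesianProductWith⁺ br (planted c (≤-trans (s≤s (m≤m+n (size c) (size s))) h))
        (subst₂ (λ a b → s ∈ shapes f a b) (sym (m+n∸m≡n (size c) (size s))) (sym (m+n∸m≡n (pleaves c)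
            (leaves s)))
          (shapes-complete f s (≤-trans (s≤s (m≤n+m (size s) (size c))) h)))))))
  where
  planted : ∀ c → size c < f → c ∈ plantedShapes f (size c) (pleaves c)
  planted ∅          _ = here refl
  planted c@(br _ _) p = shapes-complete f c p

allᵇ-∈ : ∀ {X : Set} (p : X → Bool) {xs x} → allᵇ p xs ≡ true → x ∈ xs → p x ≡ true
allᵇ-∈ p {x ∷ xs} h i with p x in e
allᵇ-∈ p h (here refl) | true = e
allᵇ-∈ p h (there i)   | true = allᵇ-∈ p h i

-- The tree is planted at one of its leaves, which accounts for the edge and the leaf missing from
-- the enumerated shapes.
exhaust : ∀ {p} e k → allᵇ p (shapes (2 + e) (1 + e) k) ≡ true →
          ∀ t → size t ≡ 2 + e → nleaves t ≡ 1 + k → ∃ λ c → t ≈ br c ∅ × p c ≡ true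
exhaust {p} e k h (br x y) s n with leafFirst x y
... | ∅ , q with trans (sym s) (size-≈ q)
... | ()
exhaust {p} e k h (br x y) s n | c@(br _ _) , q = c , ≈-trans q rot , allᵇ-∈ p h
  (subst₂ (λ a b → c ∈ shapes (2 + e) a b) s' n' (shapes-complete (2 + e) c (≤-reflexive (cong suc s'))))
  where
  s' : size c ≡ 1 + e
  s' = suc-injective (trans (sym (size-≈ q)) s)
  n' : leaves c ≡ k
  n' = suc-injective (trans (sym (nleaves-≈ q)) n)

∨-elim : ∀ {a b} → a ∨ b ≡ true → a ≢ true → b ≡ true
∨-elim {true}  h n = ⊥-elim (n refl)
∨-elim {false} h n = h

exhaust-solved : ∀ {K lo D} e k → allᵇ (solved K lo D) (shapes (2 + e) (1 + e) k) ≡ true →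
                 ∀ t → size t ≡ 2 + e → nleaves t ≡ 1 + k → Colourable K lo t
exhaust-solved {K} {lo} {D} e k h t s n with exhaust e k h t s n
... | c , p , q = Colourable-≈ (≈-sym p) (solved-sound K lo D c q)

exhaust-many-twos : ∀ e k → allᵇ (λ t → suc k <ᵇ twos (br t ∅)) (shapes (2 + e) (1 + e) k) ≡ true →
                    ∀ t → size t ≡ 2 + e → nleaves t ≡ 1 + k → nleaves t < twos t
exhaust-many-twos e k h t s n with exhaust e k h t s n
... | c , p , q = subst₂ _<_ (sym n) (sym (twos-≈ p)) (<ᵇ⇒< (suc k) _ (subst T (sym q) _))

exhaust-few-twos : ∀ {K lo D} e k → allᵇ (λ t → (suc k <ᵇ twos (br t ∅)) ∨ solved K lo D t) (shapes
    (2 + e) (1 + e) k) ≡ true →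
                   ∀ t → size t ≡ 2 + e → nleaves t ≡ 1 + k → twos t ≤ nleaves t → Colourable K lo t
exhaust-few-twos {K} {lo} {D} e k h t s n le with exhaust e k h t s n
... | c , p , q = Colourable-≈ (≈-sym p) (solved-sound K lo D c (∨-elim q λ q' →
      <⇒≱ (subst₂ _<_ (sym n) (sym (twos-≈ p)) (<ᵇ⇒< (suc k) _ (subst T (sym q') _))) le))

-- The names give the number of edges and of leaves.
base-2-2 : ∀ t → size t ≡ 2 → nleaves t ≡ 2 → Colourable 2 0 t
base-2-2 = exhaust-solved {D = 0} 0 1 refl

base-3-2 : ∀ t → size t ≡ 3 → nleaves t ≡ 2 → Colourable 3 0 t
base-3-2 = exhaust-solved {D = 0} 1 1 refl

base-5-3 : ∀ t → size t ≡ 5 → nleaves t ≡ 3 → Colourable 4 0 t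
base-5-3 = exhaust-solved {D = 0} 3 2 refl

base-6-3 : ∀ t → size t ≡ 6 → nleaves t ≡ 3 → Colourable 3 0 t
base-6-3 = exhaust-solved {D = 0} 4 2 refl

-- Five inner edges share four colours, so one colour is on two of them; in all searches with `lo` =
-- 1, `D` is this excess m - k.
base-9-4 : ∀ t → size t ≡ 9 → nleaves t ≡ 4 → twos t ≤ nleaves t → Colourable 4 1 t
base-9-4 = exhaust-few-twos {D = 1} 7 3 refl

no-4-2 : ∀ t → size t ≡ 4 → nleaves t ≡ 2 → nleaves t < twos t
no-4-2 = exhaust-many-twos 2 1 refl

no-5-2 : ∀ t → size t ≡ 5 → nleaves t ≡ 2 → nleaves t < twos t
no-5-2 = exhaust-many-twos 3 1 refl

no-6-2 : ∀ t → size t ≡ 6 → nleaves t ≡ 2 → nleaves t < twos t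
no-6-2 = exhaust-many-twos 4 1 refl

no-7-3 : ∀ t → size t ≡ 7 → nleaves t ≡ 3 → nleaves t < twos t
no-7-3 = exhaust-many-twos 5 2 refl

no-8-3 : ∀ t → size t ≡ 8 → nleaves t ≡ 3 → nleaves t < twos t
no-8-3 = exhaust-many-twos 6 2 refl

no-10-4 : ∀ t → size t ≡ 10 → nleaves t ≡ 4 → nleaves t < twos t
no-10-4 = exhaust-many-twos 8 3 refl

base-11-5 : ∀ t → size t ≡ 11 → nleaves t ≡ 5 → Colourable 5 1 t
base-11-5 = exhaust-solved {D = 1} 9 4 refl

base-12-5 : ∀ t → size t ≡ 12 → nleaves t ≡ 5 → Colourable 5 1 t
base-12-5 = exhaust-solved {D = 2} 10 4 refl

-- Descent to the base cases

m≤n⇒∃[o]o+m≡n : ∀ {m n} → m ≤ n → ∃ λ o → o + m ≡ n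
m≤n⇒∃[o]o+m≡n m≤n = _ , m∸n+n≡m m≤n

-- `j` counts the colours beyond the number of leaves. Cutting off a twig keeps `m` and lowers `k`;
-- as m ≤ k₀, twigs exist all the way down to `k₀`.
grow : ∀ j {m k₀} → 2 ≤ k₀ → m ≤ k₀ →
       (∀ t → size t ≡ k₀ + m → nleaves t ≡ k₀ → Colourable (k₀ + j) 0 t) →
       ∀ i t → size t ≡ i + k₀ + m → nleaves t ≡ i + k₀ → Colourable (i + k₀ + j) 0 t
grow j {m} {k₀} 2≤k₀ m≤k₀ base zero t s n = base t s n
grow j {m} {k₀} 2≤k₀ m≤k₀ base (suc i) t s n with twig t k≥3 s<2k
  where
  k = suc (i + k₀)
  k≥3 : 3 ≤ nleaves t
  k≥3 = subst (3 ≤_) (sym n) (s≤s (≤-trans 2≤k₀ (m≤n+m k₀ i)))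
  s<2k : size t < 2 * nleaves t
  s<2k = subst₂ _<_ (sym s) (sym (trans (cong (2 *_) n) (cong (k +_) (+-identityʳ k))))
           (+-monoʳ-< k (s≤s (≤-trans m≤k₀ (m≤n+m k₀ i))))
... | c@(br x (br y z)) , p , w = Colourable-≈ (≈-sym p) (addLeaf
  (grow j 2≤k₀ m≤k₀ base i c (suc-injective (trans (sym (size-≈ p)) s))
                             (suc-injective (trans (cong suc (sym (nleaves-wide {br x (br y z)} w)))
                                 (trans (sym (nleaves-≈ p)) n)))))
... | br _ ∅ , p , s≤s ()

-- `D` is m - k, which every reduction preserves; D ≤ 2 is the range in which reductions exist.
shrink : ∀ {D lo k₀} → D ≤ 2 → lo ≤ 1 → 2 ≤ k₀ →
         (∀ t → size t ≡ 2 * k₀ + D → nleaves t ≡ k₀ → Colourable k₀ lo t) →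
         ∀ i t → size t ≡ 2 * (i + k₀) + D → nleaves t ≡ i + k₀ → Colourable (i + k₀) lo t
shrink D≤2 lo≤1 2≤k₀ base zero t s n = base t s n
shrink {D} {lo} {k₀} D≤2 lo≤1 2≤k₀ base (suc i) t s n =
  colouring lo≤1 (shrink D≤2 lo≤1 2≤k₀ base i smaller s' (suc-injective (trans (sym leaves-) n)))
  where
  s≡ : size t ≡ 2 * nleaves t + D
  s≡ = trans s (cong (λ k → 2 * k + D) (sym n))
  open Reduction (reduction t (subst (3 ≤_) (sym n) (s≤s (≤-trans 2≤k₀ (m≤n+m k₀ i))))
                   (subst (2 * nleaves t ≤_) (sym s≡) (m≤m+n _ D))
                   (subst (_≤ 2 * nleaves t + 2) (sym s≡) (+-monoʳ-≤ (2 * nleaves t) D≤2)))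
  s' : size smaller ≡ 2 * (i + k₀) + D
  s' = +-cancelˡ-≡ 2 _ _ (trans (sym size-) (trans s (cong (_+ D) (*-distribˡ-+ 2 1 (i + k₀)))))

colour₀ : ∀ k → 3 ≤ k → ∀ t → size t ≡ k + k → nleaves t ≡ k → Colourable k 0 t
colour₀ k k≥3 t s n with m≤n⇒∃[o]o+m≡n k≥3
... | i , refl = shrink z≤n z≤n (s≤s (s≤s z≤n)) (λ t s n → base-6-3 t s n) i t
  (trans s (trans (cong (k +_) (sym (+-identityʳ k))) (sym (+-identityʳ _)))) n

-- `extra` stands for m ≤ 2, where it is left open whether `k` colours suffice.
data Outcome (t : Shape) (k : ℕ) : Set where
  equitable : ∀ lo → Colourable k lo t → Outcome t k
  extra     : size t ≤ k + 2 → Colourable (suc k) 0 t → Outcome t k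

outcome : ∀ t k m → 2 ≤ k → size t ≡ k + m → nleaves t ≡ k → twos t ≤ k → m ≤ k + 2 → Outcome t k
outcome t k 0 k≥2 s n tw le with m≤n⇒∃[o]o+m≡n k≥2
... | i , refl = equitable 0 (subst (λ K → Colourable K 0 t) (+-identityʳ k)
                   (grow 0 ≤-refl z≤n (λ t s n → base-2-2 t s n) i t s n))
outcome t k 1 k≥2 s n tw le with m≤n⇒∃[o]o+m≡n k≥2
... | i , refl = extra (≤-trans (≤-reflexive s) (+-monoʳ-≤ k (s≤s z≤n))) (subst (λ K → Colourable K 0 t)
      (+-comm k 1)
                   (grow 1 ≤-refl (s≤s z≤n) (λ t s n → base-3-2 t s n) i t s n))
outcome t 1 (suc (suc _)) (s≤s ())
outcome t 2 2 k≥2 s n tw le = ⊥-elim (<⇒≱ (no-4-2 t s n) (subst (twos t ≤_) (sym n) tw))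
outcome t (suc (suc (suc k))) 2 k≥2 s n tw le with m≤n⇒∃[o]o+m≡n (s≤s (s≤s (s≤s (z≤n {k}))))
... | i , e = extra (≤-reflexive s) (subst (λ K → Colourable K 0 t) (trans (cong (_+ 1) e) (+-comm _ 1))
                (grow 1 (s≤s (s≤s z≤n)) (s≤s (s≤s z≤n)) (λ t s n → base-5-3 t s n) i t (trans s (cong
                    (_+ 2) (sym e))) (trans n (sym e))))
outcome t k m@(suc (suc (suc _))) k≥2 s n tw le with m ≤? k
... | yes m≤k with m≤n⇒∃[o]o+m≡n m≤k
-- Twigs are cut off until k = m; then `colour₀` descends along k = m to three leaves.
... | i , refl = equitable 0 (subst (λ K → Colourable K 0 t) (+-identityʳ k)
      (grow 0 (s≤s (s≤s z≤n)) ≤-refl (λ t s n → subst (λ K → Colourable K 0 t) (sym (+-identityʳ m))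
          (colour₀ m (s≤s (s≤s (s≤s z≤n))) t s n)) i t s n))
outcome t k m k≥2 s n tw le | no m≰k with m≤n⇒∃[o]o+m≡n (≰⇒> m≰k)
... | 0 , refl = one k k≥2 s n tw
  where
  one : ∀ k → 2 ≤ k → size t ≡ k + suc k → nleaves t ≡ k → twos t ≤ k → Outcome t k
  one 2 _ s n tw = ⊥-elim (<⇒≱ (no-5-2 t s n) (subst (twos t ≤_) (sym n) tw))
  one 3 _ s n tw = ⊥-elim (<⇒≱ (no-7-3 t s n) (subst (twos t ≤_) (sym n) tw))
  -- The hypothesis on degree two is used here and is lost in reductions, so four leaves are
  -- searched apart and the induction starts at five.
  one 4 _ s n tw = equitable 1 (base-9-4 t s n (subst (twos t ≤_) (sym n) tw))
  one (suc (suc (suc (suc (suc k'))))) _ s n tw with m≤n⇒∃[o]o+m≡n (s≤s (s≤s (s≤s (s≤s (s≤s (z≤n {k'}))))))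
  ... | i , e = equitable 1 (subst (λ K → Colourable K 1 t) e
        (shrink (s≤s z≤n) ≤-refl (s≤s (s≤s z≤n)) (λ t s n → base-11-5 t s n) i t
          (trans s (trans (solve 1 (λ k → k :+ (con 1 :+ k) := con 2 :* k :+ con 1) refl (5 + k')) (cong
              (λ K → 2 * K + 1) (sym e)))) (trans n (sym e))))
    where open +-*-Solver
  one 1 (s≤s ())
... | 1 , refl = two k k≥2 s n tw
  where
  two : ∀ k → 2 ≤ k → size t ≡ k + suc (suc k) → nleaves t ≡ k → twos t ≤ k → Outcome t k
  two 2 _ s n tw = ⊥-elim (<⇒≱ (no-6-2 t s n) (subst (twos t ≤_) (sym n) tw))
  two 3 _ s n tw = ⊥-elim (<⇒≱ (no-8-3 t s n) (subst (twos t ≤_) (sym n) tw))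
  two 4 _ s n tw = ⊥-elim (<⇒≱ (no-10-4 t s n) (subst (twos t ≤_) (sym n) tw))
  two (suc (suc (suc (suc (suc k'))))) _ s n tw with m≤n⇒∃[o]o+m≡n (s≤s (s≤s (s≤s (s≤s (s≤s (z≤n {k'}))))))
  ... | i , e = equitable 1 (subst (λ K → Colourable K 1 t) e
        (shrink ≤-refl ≤-refl (s≤s (s≤s z≤n)) (λ t s n → base-12-5 t s n) i t
          (trans s (trans (solve 1 (λ k → k :+ (con 2 :+ k) := con 2 :* k :+ con 2) refl (5 + k')) (cong
              (λ K → 2 * K + 2) (sym e)))) (trans n (sym e))))
    where open +-*-Solver
  two 1 (s≤s ())
... | suc (suc o) , e = ⊥-elim (<-irrefl refl (≤-trans (m≤n+m (suc k) o)
  (s≤s⁻¹ (s≤s⁻¹ (subst₂ _≤_ (sym e) (+-comm k 2) le)))))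

Unique-++⁻ : ∀ {A : Set} (xs : List A) {ys} → Unique (xs ++ ys) →
             Unique xs × Unique ys × (∀ {x} → x ∈ xs → x ∉ ys)
Unique-++⁻ []       u       = [] , u , λ ()
Unique-++⁻ (x ∷ xs) (p ∷ u) with Unique-++⁻ xs u
... | ux , uy , d = (++⁻ˡ xs p ∷ ux) , uy , λ { (here refl) j → All.lookup (++⁻ʳ xs p) j refl ;
      (there i) j → d i j }

-- Spanning trees of connected graphs

module Span {n} (G : Graph n) where

  E = Edge G
  V = Fin n
  open DecMem (FinP._≟_ {n}) using () renaming (_∈?_ to _∈ᶠ?_)

  Joins : E → V → V → Set
  Joins e x y = ends G e ≡ (x , y) ⊎ ends G e ≡ (y , x)

  joins-sym : ∀ {e x y} → Joins e x y → Joins e y x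
  joins-sym (inj₁ p) = inj₂ p
  joins-sym (inj₂ p) = inj₁ p

  incident : ∀ {e x y w} → Joins e x y → Incident G w e → w ≡ x ⊎ w ≡ y
  incident (inj₁ p) (inj₁ q) = inj₁ (trans (sym q) (cong proj₁ p))
  incident (inj₁ p) (inj₂ q) = inj₂ (trans (sym q) (cong proj₂ p))
  incident (inj₂ p) (inj₁ q) = inj₂ (trans (sym q) (cong proj₁ p))
  incident (inj₂ p) (inj₂ q) = inj₁ (trans (sym q) (cong proj₂ p))

  joins-left : ∀ {e x y} → Joins e x y → Incident G x e
  joins-left (inj₁ p) = inj₁ (cong proj₁ p)
  joins-left (inj₂ p) = inj₂ (cong proj₂ p)

  joins-right : ∀ {e x y} → Joins e x y → Incident G y e
  joins-right p = joins-left (joins-sym p)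

  private variable
    p v w x y z : V
    e : E

  Tree : Shape → Set
  Tree = Lab (E × V)

  data Valid : V → Tree t → Set where
    ∅  : Valid p ∅
    br : ∀ {c s} {T : Tree c} {U : Tree s} →
         Joins e p v → Valid v T → Valid p U → Valid p (br (e , v) T U)

  verts : Tree t → List V
  verts ∅                = []
  verts (br (e , v) T U) = v ∷ verts T ++ verts U

  edgesOf : Tree t → List E
  edgesOf ∅                = []
  edgesOf (br (e , v) T U) = e ∷ edgesOf T ++ edgesOf U

  insert : (T : Tree t) → Valid p T → x ∈ p ∷ verts T → Joins e x y →
           ∃ λ t' → Σ (Tree t') λ T' → Valid p T' × verts T' ↭ y ∷ verts T
  insert T val (here refl) j = _ , br (_ , _) ∅ T , br j ∅ val , ↭-refl
  insert {y = y} (br (e , v) T U) (br j' valT valU) (there (here refl)) j with insert T valT (here refl) j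
  ... | _ , T' , val' , q = _ , br (e , v) T' U , br j' val' valU , ↭-trans (prep v (++⁺ʳ (verts U) q))
        (swap v y ↭-refl)
  insert {y = y} (br (e , v) T U) (br j' valT valU) (there (there i)) j with ∈-++⁻ (verts T) i
  ... | inj₁ i' with insert T valT (there i') j
  ... | _ , T' , val' , q = _ , br (e , v) T' U , br j' val' valU , ↭-trans (prep v (++⁺ʳ (verts U) q))
        (swap v y ↭-refl)
  insert {y = y} (br (e , v) T U) (br j' valT valU) (there (there i)) j | inj₂ i' with insert U valU (there i') j
  ... | _ , U' , val' , q = _ , br (e , v) T U' , br j' valT val' ,
    ↭-trans (prep v (↭-trans (++⁺ˡ (verts T) q) (shift y (verts T) (verts U)))) (swap v y ↭-refl)

  record Partial (r : V) : Set where
    constructor partial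
    field
      {shape} : Shape
      tree    : Tree shape
      valid   : Valid r tree
      unique  : Unique (r ∷ verts tree)
    covered : List V
    covered = r ∷ verts tree
  open Partial

  _⊑_ : ∀ {r} → Partial r → Partial r → Set
  P ⊑ Q = ∀ {v} → v ∈ covered P → v ∈ covered Q

  attach : ∀ {r} (P : Partial r) → x ∈ covered P → Adj G x y → ∃ λ Q → P ⊑ Q × y ∈ covered Q
  attach {y = y} {r = r} P i (e , j) with y ∈ᶠ? covered P
  ... | yes k = P , (λ m → m) , k
  ... | no ¬k with insert (tree P) (valid P) i j
  ... | _ , T' , val' , q = partial T' val' (Unique-↭ (↭-sym q') (All.tabulate (λ m e → ¬k (subst
        (_∈ covered P) (sym e) m)) ∷ unique P))
                          , (λ m → ∈-resp-↭ (↭-sym q') (there m)) , ∈-resp-↭ (↭-sym q') (here refl)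
    where
    q' : r ∷ verts T' ↭ y ∷ covered P
    q' = ↭-trans (prep r q) (swap r y ↭-refl)

  extend : ∀ {r} (P : Partial r) → x ∈ covered P → Star (Adj G) x y → ∃ λ Q → P ⊑ Q × y ∈ covered Q
  extend P i ε = P , (λ m → m) , i
  extend P i (a ◅ as) with attach P i a
  ... | Q , f , j with extend Q j as
  ... | R , g , k = R , (λ m → g (f m)) , k

  extendAll : Connected G → ∀ {r} (P : Partial r) → ∀ vs → ∃ λ Q → P ⊑ Q × (∀ {v} → v ∈ vs → v ∈ covered Q)
  extendAll con P [] = P , (λ m → m) , λ ()
  extendAll con {r} P (v ∷ vs) with extend P (here refl) (con r v)
  ... | Q , f , j with extendAll con Q vs
  ... | R , g , h = R , (λ m → g (f m)) , λ { (here refl) → g j ; (there i) → h i }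

  data Path : V → List V → V → Set where
    stop : Path x (x ∷ []) x
    step : ∀ {l} → Adj G x y → Path y l z → Path x (x ∷ l) z

  append : ∀ {l l'} → Path x l y → Adj G y z → Path z l' w → Path x (l ++ l') w
  append stop       a q = step a q
  append (step b p) a q = step b (append p a q)

  path-chain : ∀ {l} → Path x l y → Chain G l × head l ≡ just x × last l ≡ just y
  path-chain stop = tt , refl , refl
  path-chain (step a stop) = (a , tt) , refl , refl
  path-chain (step a q@(step b r)) with path-chain q
  ... | c , _ , l = (a , c) , refl , l

  path-long : ∀ {l} → Path x l y → x ≢ y → 2 ≤ length l
  path-long stop n = ⊥-elim (n refl)
  path-long (step a stop) n = s≤s (s≤s z≤n)
  path-long (step a (step b r)) n = s≤s (s≤s z≤n)

  Simple : List V → V → V → List V → Set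
  Simple S x y l = Path x l y × Unique l × (∀ {w} → w ∈ l → w ∈ S)

  module _ {v : V} (S S' : List V) where
    inT : ∀ {w} → w ∈ v ∷ S → w ∈ v ∷ S ++ S'
    inT (here q)  = here q
    inT (there i) = there (∈-++⁺ˡ i)
    inU : ∀ {w p} → w ∈ p ∷ S' → w ∈ p ∷ v ∷ S ++ S'
    inU (here q)  = here q
    inU (there i) = there (there (∈-++⁺ʳ S i))
    outside : ∀ {w p} → w ∈ p ∷ v ∷ S ++ S' → w ∈ v ∷ S ⊎ w ∈ p ∷ S'
    outside (here q)          = inj₂ (here q)
    outside (there (here q))  = inj₁ (here q)
    outside (there (there i)) with ∈-++⁻ S i
    ... | inj₁ j = inj₁ (there j)
    ... | inj₂ j = inj₂ (there j)
    sides : ∀ {p} → Unique (p ∷ v ∷ S ++ S') →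
            Unique (v ∷ S) × Unique (p ∷ S') × (∀ {w} → w ∈ v ∷ S → w ∉ p ∷ S')
    sides {p} ((q ∷ qs) ∷ (us ∷ u)) with Unique-++⁻ S u
    ... | uT , uU , d = (++⁻ˡ S us ∷ uT) , (++⁻ʳ S qs ∷ uU) ,
      λ { (here refl) (here refl) → q refl
        ; (here refl) (there j) → All.lookup (++⁻ʳ S us) j refl
        ; (there i) (here refl) → All.lookup (++⁻ˡ S qs) i refl
        ; (there i) (there j) → d i j }

  down : (T : Tree t) → Valid p T → Unique (p ∷ verts T) → x ∈ p ∷ verts T →
         ∃ λ l → Simple (p ∷ verts T) p x l
  down T val u (here refl) = _ , stop , [] ∷ [] , λ { (here q) → here q }
  down (br (e , v) T U) (br j valT valU) u (there i) with sides (verts T) (verts U) u | outside (verts T) (verts U) (there i)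
  ... | uT , uU , d | inj₁ k with down T valT uT k
  ... | l , pa , ul , m = _ , step (e , j) pa , (All.tabulate (λ w q → d (m w) (here (sym q))) ∷ ul)
                        , λ { (here q) → here q ; (there w) → there (inT (verts T) (verts U) (m w)) }
  down (br (e , v) T U) (br j valT valU) u (there i) | uT , uU , d | inj₂ k with down U valU uU k
  ... | l , pa , ul , m = l , pa , ul , λ w → inU (verts T) (verts U) (m w)

  up : (T : Tree t) → Valid p T → Unique (p ∷ verts T) → x ∈ p ∷ verts T →
       ∃ λ l → Simple (p ∷ verts T) x p l
  up T val u (here refl) = _ , stop , [] ∷ [] , λ { (here q) → here q }
  up {p = p} (br (e , v) T U) (br j valT valU) u (there i) with sides (verts T) (verts U) u | outside (verts T) (verts U) (there i)
  ... | uT , uU , d | inj₁ k with up T valT uT k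
  ... | l , pa , ul , m = _ , append pa (e , joins-sym j) stop
                        , UniqueP.++⁺ ul ([] ∷ []) (λ { (i , here refl) → d (m i) (here refl) })
                        , λ w → mem (∈-++⁻ l w)
    where
    mem : ∀ {w} → w ∈ l ⊎ w ∈ p ∷ [] → w ∈ p ∷ verts (br (e , v) T U)
    mem (inj₁ i)        = there (inT (verts T) (verts U) (m i))
    mem (inj₂ (here q)) = here q
  up (br (e , v) T U) (br j valT valU) u (there i) | uT , uU , d | inj₂ k with up U valU uU k
  ... | l , pa , ul , m = l , pa , ul , λ w → inU (verts T) (verts U) (m w)

  -- For adjacent vertices the second alternative closes up to a cycle, since three vertices are
  -- enough for one.
  Connection : List E → List V → V → V → Set
  Connection es S x y = (∃ λ e → e ∈ es × Joins e x y) ⊎ (∃ λ l → 3 ≤ length l × Simple S x y l)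

  join : ∀ {A B S es x v p y l l'} → Simple A x v l → Simple B p y l' → Joins e v p → e ∈ es →
         (∀ {w} → w ∈ A → w ∉ B) → (∀ {w} → w ∈ A → w ∈ S) → (∀ {w} → w ∈ B → w ∈ S) →
         Connection es S x y
  join {e = e} {x = x} {v} {p} {y} {l} {l'} (pa , ua , ma) (pb , ub , mb) j i d f g with x FinP.≟ v | p FinP.≟ y
  ... | yes refl | yes refl = inj₁ (e , i , j)
  ... | no n | _ = inj₂ (_ , long {l} (path-long pa n) pb , append pa (e , j) pb
                      , UniqueP.++⁺ ua ub (λ (i , j) → d (ma i) (mb j)) , λ w → mem (∈-++⁻ l w))
    where
    mem : ∀ {w} → w ∈ l ⊎ w ∈ l' → _
    mem (inj₁ i) = f (ma i)
    mem (inj₂ i) = g (mb i)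
    long : ∀ {l} → 2 ≤ length l → Path p l' y → 3 ≤ length (l ++ l')
    long {_ ∷ _ ∷ []} _ stop       = s≤s (s≤s (s≤s z≤n))
    long {_ ∷ _ ∷ []} _ (step _ _) = s≤s (s≤s (s≤s z≤n))
    long {_ ∷ _ ∷ _ ∷ _} _ _       = s≤s (s≤s (s≤s z≤n))
    long {_ ∷ []} (s≤s ()) _
  ... | yes _ | no n = inj₂ (_ , long pa (path-long pb n) , append pa (e , j) pb
                      , UniqueP.++⁺ ua ub (λ (i , j) → d (ma i) (mb j)) , λ w → mem (∈-++⁻ l w))
    where
    mem : ∀ {w} → w ∈ l ⊎ w ∈ l' → _
    mem (inj₁ i) = f (ma i)
    mem (inj₂ i) = g (mb i)
    long : ∀ {l l' x} → Path x l v → 2 ≤ length l' → 3 ≤ length (l ++ l')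
    long stop h              = s≤s h
    long (step _ stop) h     = s≤s (s≤s (s≤s⁻ h))
      where
      s≤s⁻ : ∀ {m} → 2 ≤ m → 1 ≤ m
      s≤s⁻ (s≤s _) = s≤s z≤n
    long (step _ (step _ q)) h = s≤s (s≤s (pos q))
      where
      pos : ∀ {x l l'} → Path x l v → 1 ≤ length (l ++ l')
      pos stop       = s≤s z≤n
      pos (step _ _) = s≤s z≤n

  weaken-connection : ∀ {es es' S S' x y} → (∀ {e} → e ∈ es → e ∈ es') → (∀ {w} → w ∈ S → w ∈ S') →
          Connection es S x y → Connection es' S' x y
  weaken-connection f g (inj₁ (e , i , j))              = inj₁ (e , f i , j)
  weaken-connection f g (inj₂ (l , h , pa , u , m))     = inj₂ (l , h , pa , u , λ i → g (m i))

  -- Between vertices on different sides of the first branch the path climbs on one side, crosses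
  -- the branch and descends on the other; it is a single tree edge just when both partial paths are
  -- trivial.
  connection : (T : Tree t) → Valid p T → Unique (p ∷ verts T) →
               x ∈ p ∷ verts T → y ∈ p ∷ verts T → x ≢ y → Connection (edgesOf T) (p ∷ verts T) x y
  connection ∅ val u (here refl) (here refl) n = ⊥-elim (n refl)
  connection (br (e , v) T U) (br j valT valU) u i k n with sides (verts T) (verts U) u | outside (verts T) (verts U) i | outside (verts T) (verts U) k
  ... | uT , uU , d | inj₁ i' | inj₁ k' = weaken-connection (λ m → there (∈-++⁺ˡ m)) (λ m → there (inT
        (verts T) (verts U) m)) (connection T valT uT i' k' n)
  ... | uT , uU , d | inj₂ i' | inj₂ k' = weaken-connection (λ m → there (∈-++⁺ʳ (edgesOf T) m)) (inU
        (verts T) (verts U)) (connection U valU uU i' k' n)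
  ... | uT , uU , d | inj₁ i' | inj₂ k' = join (proj₂ (up T valT uT i')) (proj₂ (down U valU uU k'))
        (joins-sym j) (here refl) d (λ m → there (inT (verts T) (verts U) m)) (inU (verts T) (verts U))
  ... | uT , uU , d | inj₂ i' | inj₁ k' = join (proj₂ (up U valU uU i')) (proj₂ (down T valT uT k')) j
        (here refl) (λ m m' → d m' m) (inU (verts T) (verts U)) (λ m → there (inT (verts T) (verts U) m))

-- Trees as shapes labelled by their own edges

relab : ∀ {A B : Set} {t} → (A → B) → Lab A t → Lab B t
relab f ∅          = ∅
relab f (br a c s) = br (f a) (relab f c) (relab f s)

lookup-injective : ∀ {A : Set} {xs : List A} → Unique xs → ∀ i j → lookup xs i ≡ lookup xs j → i ≡ j
lookup-injective (p ∷ u) zero zero q = refl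
lookup-injective (p ∷ u) zero (suc j) q = ⊥-elim (All.lookup p (∈-lookup j) q)
lookup-injective (p ∷ u) (suc i) zero q = ⊥-elim (All.lookup p (∈-lookup i) (sym q))
lookup-injective (p ∷ u) (suc i) (suc j) q = cong Fin.suc (lookup-injective u i j q)

-- A tree whose branches are labelled by the edges of G, together with the vertex carrying each star.
record Rooted {n} (G : Graph n) : Set where
  field
    {shape}  : Shape
    tree     : Lab (Edge G) shape
    at       : List (Fin n × List (Edge G))
    at-stars : map proj₂ at ≡ stars tree
    vertices-unique : Unique (map proj₁ at)
    vertices-all    : ∀ v → v ∈ map proj₁ at
    edges-unique    : Unique (labels tree)
    edges-all       : ∀ e → e ∈ labels tree
    sound    : ∀ {v s e} → (v , s) ∈ at → e ∈ s → Incident G v e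
    complete : ∀ {v s e} → (v , s) ∈ at → Incident G v e → e ∈ s
    stars-unique : All Unique (stars tree)

heads⊆labels : ∀ {A : Set} {t} (x : Lab A t) {a} → a ∈ heads x → a ∈ labels x
heads⊆labels (br a c s) (here q)  = here q
heads⊆labels (br a c s) (there i) = there (∈-++⁺ʳ (labels c) (heads⊆labels s i))

unique-stars : ∀ {A : Set} {t} (x : Lab A t) → Unique (labels x) → All Unique (stars x)
unique-stars ∅ _ = [] ∷ []
unique-stars (br a c s) (p ∷ u) with Unique-++⁻ (labels c) u
... | uc , us , d with unique-stars c uc | unique-stars s us
... | hc ∷ bc | hs ∷ bs =
    (All.tabulate (λ i → All.lookup (++⁻ʳ (labels c) p) (heads⊆labels s i)) ∷ hs)
  ∷ (All.tabulate (λ i → All.lookup (++⁻ˡ (labels c) p) (heads⊆labels c i)) ∷ hc)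
  ∷ AllP.++⁺ bc bs

module Build {n} (G : Graph n) (isTree : IsTree G) where
  open Span G

  private variable
    p v w x y : V
    e : E

  ordered-ends : ∀ e → proj₁ (ends G e) Fin.< proj₂ (ends G e)
  ordered-ends e = All.lookup (ordered G) (∈-lookup e)

  joins-unique : ∀ {e e'} → ends G e ≡ (x , y) → Joins e' x y → e ≡ e'
  joins-unique {e = e} {e'} q (inj₁ r) = lookup-injective (simple G) e e' (trans q (sym r))
  joins-unique {x = x} {y = y} {e = e} {e'} q (inj₂ r) = ⊥-elim (FinP.<-asym
    (subst (λ p → proj₁ p Fin.< proj₂ p) q (ordered-ends e)) (subst (λ p → proj₁ p Fin.< proj₂ p) r
        (ordered-ends e')))

  -- An edge outside the spanning tree would close the tree path between its ends to a cycle.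
  edges-span : (T : Tree t) → Valid p T → Unique (p ∷ verts T) → (∀ v → v ∈ p ∷ verts T) → ∀ e → e ∈ edgesOf T
  edges-span T val u all e with connection T val u (all (proj₁ (ends G e))) (all (proj₂ (ends G e)))
                                  (λ q → FinP.<-irrefl q (ordered-ends e))
  ... | inj₁ (e' , i , j) rewrite joins-unique {e = e} {e'} refl j = i
  ... | inj₂ (l , 3≤ , pa , ul , _) = ⊥-elim (proj₂ isTree (l , _ , _ , 3≤ , ul ,
          (let c , h , k = path-chain pa in c , h , k , e , inj₂ refl)))

  ends-inside : (T : Tree t) → Valid p T → e ∈ edgesOf T → Incident G w e → w ∈ p ∷ verts T
  ends-inside (br (e , v) T U) (br j valT valU) (here refl) inc with incident j inc
  ... | inj₁ refl = here refl
  ... | inj₂ refl = there (here refl)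
  ends-inside (br (e , v) T U) (br j valT valU) (there i) inc with ∈-++⁻ (edgesOf T) i
  ... | inj₁ k = there (inT (verts T) (verts U) (ends-inside T valT k inc))
  ... | inj₂ k = inU (verts T) (verts U) (ends-inside U valU k inc)

  edges-distinct : (T : Tree t) → Valid p T → Unique (p ∷ verts T) → Unique (edgesOf T)
  edges-distinct ∅ val u = []
  edges-distinct (br (e , v) T U) (br j valT valU) u with sides (verts T) (verts U) u
  ... | uT , uU , d =
    All.tabulate (λ i q → notin (∈-++⁻ (edgesOf T) i) q)
    ∷ UniqueP.++⁺ (edges-distinct T valT uT) (edges-distinct U valU uU)
        (λ (i , k) → d (ends-inside T valT i (inj₁ refl)) (ends-inside U valU k (inj₁ refl)))
    where
    notin : ∀ {e'} → e' ∈ edgesOf T ⊎ e' ∈ edgesOf U → e ≡ e' → ⊥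
    notin (inj₁ i) refl = d (ends-inside T valT i (joins-left j)) (here refl)
    notin (inj₂ i) refl = d (here refl) (ends-inside U valU i (joins-right j))

  top : Tree t → List E
  top T = map proj₁ (heads T)

  atBelow : Tree t → List (V × List E)
  atBelow ∅                = []
  atBelow (br (e , v) T U) = (v , e ∷ top T) ∷ atBelow T ++ atBelow U

  top-relab : (T : Tree t) → top T ≡ heads (relab proj₁ T)
  top-relab ∅ = refl
  top-relab (br a T U) = cong (_ ∷_) (top-relab U)

  atBelow-stars : (T : Tree t) → map proj₂ (atBelow T) ≡ below (relab proj₁ T)
  atBelow-stars ∅ = refl
  atBelow-stars (br (e , v) T U) = cong₂ _∷_ (cong (e ∷_) (top-relab T))
    (trans (map-++ proj₂ (atBelow T) (atBelow U)) (cong₂ _++_ (atBelow-stars T) (atBelow-stars U)))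

  atBelow-verts : (T : Tree t) → map proj₁ (atBelow T) ≡ verts T
  atBelow-verts ∅ = refl
  atBelow-verts (br (e , v) T U) = cong (v ∷_)
    (trans (map-++ proj₁ (atBelow T) (atBelow U)) (cong₂ _++_ (atBelow-verts T) (atBelow-verts U)))

  edgesOf-relab : (T : Tree t) → labels (relab proj₁ T) ≡ edgesOf T
  edgesOf-relab ∅ = refl
  edgesOf-relab (br (e , v) T U) = cong (e ∷_) (cong₂ _++_ (edgesOf-relab T) (edgesOf-relab U))

  top-sound : (T : Tree t) → Valid p T → e ∈ top T → Incident G p e
  top-sound (br (e , v) T U) (br j valT valU) (here refl) = joins-left j
  top-sound (br (e , v) T U) (br j valT valU) (there i) = top-sound U valU i

  below-sound : ∀ {s} (T : Tree t) → Valid p T → (w , s) ∈ atBelow T → e ∈ s → Incident G w e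
  below-sound (br (e , v) T U) (br j valT valU) (here refl) (here refl) = joins-right j
  below-sound (br (e , v) T U) (br j valT valU) (here refl) (there i) = top-sound T valT i
  below-sound (br (e , v) T U) (br j valT valU) (there m) i with ∈-++⁻ (atBelow T) m
  ... | inj₁ k = below-sound T valT k i
  ... | inj₂ k = below-sound U valU k i

  ∈-verts : ∀ {s} (T : Tree t) → (w , s) ∈ atBelow T → w ∈ verts T
  ∈-verts T m = subst (_ ∈_) (atBelow-verts T) (∈-map⁺ proj₁ m)

  top-complete : (T : Tree t) → Valid p T → Unique (p ∷ verts T) → e ∈ edgesOf T → Incident G p e → e ∈ top T
  top-complete (br (e , v) T U) val u (here refl) inc = here refl
  top-complete (br (e , v) T U) (br j valT valU) u (there i) inc with sides (verts T) (verts U) u | ∈-++⁻ (edgesOf T) i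
  ... | uT , uU , d | inj₁ k = ⊥-elim (d (ends-inside T valT k inc) (here refl))
  ... | uT , uU , d | inj₂ k = there (top-complete U valU uU k inc)

  below-complete : ∀ {s} (T : Tree t) → Valid p T → Unique (p ∷ verts T) →
                   (w , s) ∈ atBelow T → e ∈ edgesOf T → Incident G w e → e ∈ s
  below-complete (br (e , v) T U) (br j valT valU) u m i inc with sides (verts T) (verts U) u
  below-complete (br (e , v) T U) (br j valT valU) u (here refl) (here refl) inc | _ = here refl
  below-complete (br (e , v) T U) (br j valT valU) u (here refl) (there i) inc | uT , uU , d with ∈-++⁻ (edgesOf T) i
  ... | inj₁ k = there (top-complete T valT uT k inc)
  ... | inj₂ k = ⊥-elim (d (here refl) (ends-inside U valU k inc))
  below-complete (br (e , v) T U) (br j valT valU) u (there m) i inc | uT , uU , d with ∈-++⁻ (atBelow T) m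
  below-complete (br (e , v) T U) (br j valT valU) u (there m) (there i) inc | uT , uU , d | inj₁ m' with ∈-++⁻ (edgesOf T) i
  ... | inj₁ k = below-complete T valT uT m' k inc
  ... | inj₂ k = ⊥-elim (d (there (∈-verts T m')) (ends-inside U valU k inc))
  below-complete (br (e , v) T U) (br j valT valU) u (there m) (there i) inc | uT , uU , d | inj₂ m' with ∈-++⁻ (edgesOf T) i
  ... | inj₁ k = ⊥-elim (d (ends-inside T valT k inc) (there (∈-verts U m')))
  ... | inj₂ k = below-complete U valU uU m' k inc
  below-complete (br (e , v) T U) (br j valT valU) u (there m) (here refl) inc | uT , uU , d | inj₁ m' with incident j inc
  ... | inj₁ refl = ⊥-elim (d (there (∈-verts T m')) (here refl))
  ... | inj₂ refl = ⊥-elim (All.lookup (AllPairs.head uT) (∈-verts T m') refl)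
  below-complete (br (e , v) T U) (br j valT valU) u (there m) (here refl) inc | uT , uU , d | inj₂ m' with incident j inc
  ... | inj₁ refl = ⊥-elim (All.lookup (AllPairs.head uU) (∈-verts U m') refl)
  ... | inj₂ refl = ⊥-elim (d (here refl) (there (∈-verts U m')))

  rooted : V → Rooted G
  rooted r with extendAll (proj₁ isTree) (partial {r} ∅ ∅ ([] ∷ [])) (allFin n)
  ... | partial T val u , _ , all = record
    { tree     = relab proj₁ T
    ; at       = (r , top T) ∷ atBelow T
    ; at-stars = cong₂ _∷_ (top-relab T) (atBelow-stars T)
    ; vertices-unique = subst (λ vs → Unique (r ∷ vs)) (sym (atBelow-verts T)) u
    ; vertices-all    = λ v → subst (λ vs → v ∈ r ∷ vs) (sym (atBelow-verts T)) (all (∈-allFin v))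
    ; edges-unique    = uE
    ; edges-all       = λ e → subst (e ∈_) (sym (edgesOf-relab T)) (span e)
    ; sound    = λ { (here refl) i → top-sound T val i ; (there m) i → below-sound T val m i }
    ; complete = λ { (here refl) inc → top-complete T val u (span _) inc
                   ; (there m) inc → below-complete T val u m (span _) inc }
    ; stars-unique = unique-stars (relab proj₁ T) uE
    }
    where
    span : ∀ e → e ∈ edgesOf T
    span = edges-span T val u (λ v → all (∈-allFin v))
    uE = subst Unique (sym (edgesOf-relab T)) (edges-distinct T val u)

-- Degrees read off from stars

length-labels : ∀ {A : Set} {t} (x : Lab A t) → length (labels x) ≡ size t
length-labels ∅ = refl
length-labels (br a c s) = cong suc (trans (length-++ (labels c)) (cong₂ _+_ (length-labels c)
    (length-labels s)))

length-below : ∀ {A : Set} {t} (x : Lab A t) → length (below x) ≡ size t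
length-below ∅ = refl
length-below (br a c s) = cong suc (trans (length-++ (below c)) (cong₂ _+_ (length-below c) (length-below s)))

ofLength : ∀ {A : Set} → ℕ → List (List A) → ℕ
ofLength d xs = length (filter (λ s → length s ≟ d) xs)

module _ {A : Set} where
  ofLength-≡ : ∀ d s (xs : List (List A)) → length s ≡ d → ofLength d (s ∷ xs) ≡ suc (ofLength d xs)
  ofLength-≡ d s xs q = cong length (filter-accept (λ s → length s ≟ d) {s} {xs} q)

  ofLength-≢ : ∀ d s (xs : List (List A)) → length s ≢ d → ofLength d (s ∷ xs) ≡ ofLength d xs
  ofLength-≢ d s xs q = cong length (filter-reject (λ s → length s ≟ d) {s} {xs} q)

  ofLength-↭ : ∀ d {xs ys : List (List A)} → xs ↭ ys → ofLength d xs ≡ ofLength d ys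
  ofLength-↭ d p = ↭-length (filter-↭ (λ s → length s ≟ d) p)

  ofLength-++ : ∀ d (xs ys : List (List A)) → ofLength d (xs ++ ys) ≡ ofLength d xs + ofLength d ys
  ofLength-++ d xs ys = trans (cong length (filter-++ (λ s → length s ≟ d) xs ys)) (length-++ (filter (λ s
      → length s ≟ d) xs))

  below-leaves   : ∀ {t} (x : Lab A t) → ofLength 1 (below x) ≡ leaves t
  planted-leaves : ∀ {t} a (x : Lab A t) → ofLength 1 ((a ∷ heads x) ∷ below x) ≡ pleaves t
  below-leaves ∅ = refl
  below-leaves (br a c s) = trans (ofLength-++ 1 ((a ∷ heads c) ∷ below c) (below s)) (cong₂ _+_
      (planted-leaves a c) (below-leaves s))
  planted-leaves a ∅ = refl
  planted-leaves a x@(br b c s) = trans (ofLength-≢ 1 (a ∷ heads x) (below x) (λ ())) (below-leaves x)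

  -- With the star of the root moved back, the tree appears as two planted trees, one at each end of
  -- the first edge, as in `nleaves`.
  stars-leaves : ∀ {c s} (x : Lab A (br c s)) → ofLength 1 (stars x) ≡ nleaves (br c s)
  stars-leaves (br a c s) = trans (ofLength-↭ 1 shiftStar) (trans (ofLength-++ 1 ((a ∷ heads c) ∷ below c)
      ((a ∷ heads s) ∷ below s)) (cong₂ _+_ (planted-leaves a c) (planted-leaves a s)))
    where
    shiftStar : stars (br a c s) ↭ ((a ∷ heads c) ∷ below c) ++ (a ∷ heads s) ∷ below s
    shiftStar = ↭-sym (shift (a ∷ heads s) ((a ∷ heads c) ∷ below c) (below s))

  below-twos   : ∀ {t} (x : Lab A t) → ofLength 2 (below x) ≡ btwos t
  planted-twos : ∀ {t} a (x : Lab A t) → ofLength 2 ((a ∷ heads x) ∷ below x) ≡ ptwos t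
  below-twos ∅ = refl
  below-twos (br a c s) = trans (ofLength-++ 2 ((a ∷ heads c) ∷ below c) (below s)) (cong₂ _+_
      (planted-twos a c) (below-twos s))
  planted-twos a ∅ = refl
  planted-twos a x@(br b c ∅) = trans (ofLength-≡ 2 (a ∷ heads x) (below x) refl) (cong suc (below-twos x))
  planted-twos a x@(br b c (br _ _ _)) = trans (ofLength-≢ 2 (a ∷ heads x) (below x) (λ ())) (below-twos x)

  stars-twos : ∀ {c s} (x : Lab A (br c s)) → ofLength 2 (stars x) ≡ twos (br c s)
  stars-twos (br a c s) = trans (ofLength-↭ 2 shiftStar) (trans (ofLength-++ 2 ((a ∷ heads c) ∷ below c)
      ((a ∷ heads s) ∷ below s)) (cong₂ _+_ (planted-twos a c) (planted-twos a s)))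
    where
    shiftStar : stars (br a c s) ↭ ((a ∷ heads c) ∷ below c) ++ (a ∷ heads s) ∷ below s
    shiftStar = ↭-sym (shift (a ∷ heads s) ((a ∷ heads c) ∷ below c) (below s))

-- The number of leaves as a lower bound

unique-⊆-length : ∀ {A : Set} {xs ys : List A} → Unique xs → (∀ {x} → x ∈ xs → x ∈ ys) → length xs ≤ length ys
unique-⊆-length [] f = z≤n
unique-⊆-length {xs = x ∷ xs} {ys} (p ∷ u) f with ∈-∃++ (f (here refl))
... | as , bs , refl = subst (suc (length xs) ≤_) (sym (↭-length (shift x as bs)))
  (s≤s (unique-⊆-length u λ i → drop (∈-resp-↭ (shift x as bs) (f (there i))) (All.lookup p i)))
  where
  drop : ∀ {z} → z ∈ x ∷ as ++ bs → x ≢ z → z ∈ as ++ bs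
  drop (here q)  n = ⊥-elim (n (sym q))
  drop (there i) n = i

unique-bounded : ∀ {j xs} → Unique xs → All (_< j) xs → length xs ≤ j
unique-bounded {j} u b = subst (_ ≤_) (length-upTo j) (unique-⊆-length u (λ i → ∈-upTo⁺ (All.lookup b i)))

unique-full : ∀ {j xs x} → Unique xs → All (_< j) xs → length xs ≡ j → x < j → x ∈ xs
unique-full {j} {xs} {x} u b q x<j with x ∈? xs
... | yes i = i
... | no n = ⊥-elim (<-irrefl q (unique-bounded (notIn⇒All≢ n ∷ u) (x<j ∷ b)))

singles : List (List ℕ) → List ℕ
singles []                   = []
singles ([] ∷ r)             = singles r
singles ((x ∷ []) ∷ r)       = x ∷ singles r
singles ((_ ∷ _ ∷ _) ∷ r)    = singles r

singles-length : ∀ r → length (singles r) ≡ ofLength 1 r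
singles-length [] = refl
singles-length ([] ∷ r) = trans (singles-length r) (sym (ofLength-≢ 1 [] r λ ()))
singles-length ((x ∷ []) ∷ r) = trans (cong suc (singles-length r)) (sym (ofLength-≡ 1 (x ∷ []) r refl))
singles-length (s@(_ ∷ _ ∷ _) ∷ r) = trans (singles-length r) (sym (ofLength-≢ 1 s r λ ()))

∈-singles : ∀ {x r} → x ∈ singles r → (x ∷ []) ∈ r
∈-singles {r = [] ∷ r} i = there (∈-singles i)
∈-singles {r = (_ ∷ []) ∷ r} (here refl) = here refl
∈-singles {r = (_ ∷ []) ∷ r} (there i) = there (∈-singles i)
∈-singles {r = (_ ∷ _ ∷ _) ∷ r} i = there (∈-singles i)

singles-unique : ∀ {r} → AllPairs Differ r → Unique (singles r)
singles-unique [] = []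
singles-unique {[] ∷ r} (d ∷ ds) = singles-unique ds
singles-unique {(x ∷ []) ∷ r} (d ∷ ds) = All.tabulate (λ { i refl → All.lookup d (∈-singles i) ((λ _ j
    → j) , (λ _ j → j)) }) ∷ singles-unique ds
singles-unique {(_ ∷ _ ∷ _) ∷ r} (d ∷ ds) = singles-unique ds

singles-++ : ∀ r r' → singles (r ++ r') ≡ singles r ++ singles r'
singles-++ [] r' = refl
singles-++ ([] ∷ r) r' = singles-++ r r'
singles-++ ((x ∷ []) ∷ r) r' = cong (x ∷_) (singles-++ r r')
singles-++ ((_ ∷ _ ∷ _) ∷ r) r' = singles-++ r r'

singles-bounded : ∀ {j t} (c : Lab ℕ t) → All (_< j) (labels c) → All (_< j) (singles (stars c))
singles-bounded c b = All.tabulate λ i → All.head (All.lookup (stars-All c b) (∈-singles i))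

-- Distinct one-element sets have distinct elements, so the leaves alone take `nleaves` colours.
leaves-bound : ∀ {j c s} (x : Lab ℕ (br c s)) → All (_< j) (labels x) → Vdec x → nleaves (br c s) ≤ j
leaves-bound x b v = subst (_≤ _) (trans (singles-length (stars x)) (stars-leaves x))
  (unique-bounded (singles-unique (Vdec.distinct v)) (singles-bounded x b))

count-++ : ∀ x xs ys → count x (xs ++ ys) ≡ count x xs + count x ys
count-++ x xs ys = trans (cong length (filter-++ (x ≟_) xs ys)) (length-++ (filter (x ≟_) xs))

count-unique : ∀ x {xs} → Unique xs → count x xs ≤ 1
count-unique x [] = z≤n
count-unique x {y ∷ xs} (p ∷ u) with x ≟ y
... | yes refl rewrite count-≡ x xs = s≤s (≤-reflexive (cong length (filter-none (x ≟_) p)))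
... | no n rewrite count-≢ x xs n = count-unique x u

count-∈ : ∀ {x xs} → x ∈ xs → 1 ≤ count x xs
count-∈ {x} {y ∷ xs} i with x ≟ y
... | yes refl rewrite count-≡ x xs = s≤s z≤n
count-∈ (here q) | no n = ⊥-elim (n q)
count-∈ {x} {y ∷ xs} (there i) | no n rewrite count-≢ x xs n = count-∈ i

-- Trees with at most two inner edges

leaves≤size : ∀ t → leaves t ≤ size t
leaves≤size ∅ = z≤n
leaves≤size (br ∅ s) = s≤s (leaves≤size s)
leaves≤size (br c@(br _ _) s) = m≤n⇒m≤1+n (+-mono-≤ (leaves≤size c) (leaves≤size s))

-- Every grandchild of the root is a leaf, so all inner edges are at the root.
Shallow : Shape → Set
Shallow s = ¬ Child (Child Nonempty) s

module _ where
  open ≤-Reasoning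

  tight-left : ∀ {a b x y} → x ≤ a → y ≤ b → a + b ≤ x + y → a ≤ x
  tight-left {a} {b} {x} {y} p q h = +-cancelʳ-≤ b a x (≤-trans h (+-monoʳ-≤ x q))

  tight-right : ∀ {a b x y} → x ≤ a → y ≤ b → a + b ≤ x + y → b ≤ y
  tight-right {a} {b} {x} {y} p q h = +-cancelˡ-≤ a b y (≤-trans h (+-monoˡ-≤ y p))

  no-inner : ∀ s → size s ≤ leaves s → ¬ Child Nonempty s
  no-inner (br ∅ s) h (there ch) = no-inner s (s≤s⁻¹ h) ch
  no-inner (br c@(br _ _) s) h _ = <⇒≱ h (+-mono-≤ (leaves≤size c) (leaves≤size s))

  one-inner : ∀ s → size s ≤ suc (leaves s) → Shallow s
  one-inner (br ∅ s) h (here ())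
  one-inner (br ∅ s) h (there ch) = one-inner s (s≤s⁻¹ h) ch
  one-inner (br c@(br _ _) s) h (here ch) = no-inner c (tight-left (leaves≤size c) (leaves≤size s) (s≤s⁻¹ h)) ch
  one-inner (br c@(br _ _) s) h (there ch) = one-inner s (m≤n⇒m≤1+n (tight-right {size c} (leaves≤size c)
      (leaves≤size s) (s≤s⁻¹ h))) ch

  inner : ∀ s → Child Nonempty s → leaves s < size s
  inner s ch with leaves s <? size s
  ... | yes h = h
  ... | no h  = ⊥-elim (no-inner s (≮⇒≥ h) ch)

  pleaves-child : ∀ {P s} → Child P s → pleaves s ≡ leaves s
  pleaves-child (here _)  = refl
  pleaves-child (there _) = refl

  -- If the neighbour of some leaf does not meet all inner edges, it has a child `d` with an inner
  -- edge below. That edge and the one up from `d` are already the two allowed, so the root moves to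
  -- `d`.
  shallow : ∀ c s → size (br c s) ≤ nleaves (br c s) + 2 → ∃ λ t → br c s ≈ t × Shallow t
  shallow x y h with leafFirst x y
  ... | c , p with child? (child? nonempty?) c
  ... | no n = br ∅ c , p , λ { (here ()) ; (there i) → n i }
  ... | yes ch with split ch
  ... | s₁ , d , s₂ , refl , i = br (br ∅ r) d , q , λ { (here j) → no-inner r small-r (λ-there j) ;
        (there j) → one-inner d small-d j }
    where
    r = s₁ ⊕ s₂
    λ-there : ∀ {r} → Child Nonempty (br ∅ r) → Child Nonempty r
    λ-there (there j) = j
    q : br x y ≈ br (br ∅ r) d
    q = ≈-trans p (≈-trans (front (br ∅ s₁)) rot)
    pleaves-d : pleaves d ≡ leaves d
    pleaves-d = pleaves-child i
    bound : suc (suc (size r + size d)) ≤ suc (suc (suc (leaves r + leaves d)))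
    bound = begin
      suc (suc (size r + size d))          ≡⟨ size-≈ q ⟨
      size (br x y)                        ≤⟨ h ⟩
      nleaves (br x y) + 2                 ≡⟨ cong (_+ 2) (nleaves-≈ q) ⟩
      suc (leaves r + pleaves d) + 2       ≡⟨ +-comm _ 2 ⟩
      suc (suc (suc (leaves r + pleaves d))) ≡⟨ cong (λ z → suc (suc (suc (leaves r + z)))) pleaves-d ⟩
      suc (suc (suc (leaves r + leaves d))) ∎
    b' : size r + size d ≤ leaves r + suc (leaves d)
    b' = ≤-trans (s≤s⁻¹ (s≤s⁻¹ bound)) (≤-reflexive (sym (+-suc (leaves r) (leaves d))))
    small-r : size r ≤ leaves r
    small-r = tight-left (leaves≤size r) (inner d i) b'
    small-d : size d ≤ suc (leaves d)
    small-d = tight-right {size r} (leaves≤size r) (inner d i) b'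

leaf-labels : ∀ {t} (c : Lab ℕ t) → ¬ Child Nonempty t → labels c ≡ singles (below c)
leaf-labels ∅ n = refl
leaf-labels (br a ∅ s) n = cong (a ∷_) (leaf-labels s (n ∘ there))
leaf-labels (br a (br _ _ _) s) n = ⊥-elim (n (here nonempty))

-- An edge away from the root is pendant, and its label forms a one-element star. Pendant edges at
-- the root are counted twice, whence only an inequality.
shallow-count : ∀ {t} (c : Lab ℕ t) → Shallow t → ∀ x → count x (labels c) ≤ count x (heads c) + count x
    (singles (below c))
shallow-count ∅ n x = z≤n
shallow-count (br a c s) n x = begin
  count x (a ∷ labels c ++ labels s)
    ≡⟨ count-++ x (a ∷ []) (labels c ++ labels s) ⟩
  count x (a ∷ []) + count x (labels c ++ labels s)
    ≡⟨ cong (count x (a ∷ []) +_) (count-++ x (labels c) (labels s)) ⟩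
  count x (a ∷ []) + (count x (labels c) + count x (labels s))
    ≤⟨ +-monoʳ-≤ (count x (a ∷ [])) (+-mono-≤ part (shallow-count s (n ∘ there) x)) ⟩
  count x (a ∷ []) + (count x (singles P) + (count x (heads s) + count x (singles (below s))))
    ≡⟨ cong (count x (a ∷ []) +_) (+-exchange (count x (singles P)) (count x (heads s)) _) ⟩
  count x (a ∷ []) + (count x (heads s) + (count x (singles P) + count x (singles (below s))))
    ≡⟨ +-assoc (count x (a ∷ [])) _ _ ⟨
  count x (a ∷ []) + count x (heads s) + (count x (singles P) + count x (singles (below s)))
    ≡⟨ cong₂ _+_ (count-++ x (a ∷ []) (heads s)) (trans (cong (count x) (singles-++ P (below s)))
        (count-++ x (singles P) (singles (below s)))) ⟨
  count x (a ∷ heads s) + count x (singles (P ++ below s)) ∎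
  where
  open ≤-Reasoning
  P = (a ∷ heads c) ∷ below c
  part : count x (labels c) ≤ count x (singles P)
  part = go c (λ i → n (here i))
    where
    go : ∀ {t} (c : Lab ℕ t) → ¬ Child Nonempty t → count x (labels c) ≤ count x (singles ((a ∷ heads c)
        ∷ below c))
    go ∅ _ = z≤n
    go c@(br _ _ _) m = ≤-reflexive (cong (count x) (leaf-labels c m))

-- Leaves use every colour exactly once, and the inner edges all meet the root.
shallow-good : ∀ {k t} (c : Lab ℕ t) → Shallow t → Nonempty t → nleaves t ≡ k →
               All (_< k) (labels c) → Vdec c → Good k 0 c
shallow-good {k} c@(br _ _ _) sh _ q b v = record
  { bounded  = b
  ; balanced = λ x x<k →
      count-∈ (in-labels (∈-singles (unique-full us (singles-bounded c b)
        (trans (singles-length (stars c)) (trans (stars-leaves c) q)) x<k)))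
      , ≤-trans (shallow-count c sh x) (+-mono-≤ (count-unique x (All.head (Vdec.proper v)))
          (count-unique x (singles-unique (AllPairs.tail (Vdec.distinct v)))))
  ; isVdec   = v }
  where
  us = singles-unique (Vdec.distinct v)
  in-labels : ∀ {x} → (x ∷ []) ∈ stars c → x ∈ labels c
  in-labels i = All.head (All.lookup (stars-All c (All.tabulate (λ j → j))) i)

-- Deciding whether a number of colours suffices

vdec? : ∀ {t} (c : Lab ℕ t) → Dec (Vdec c)
vdec? c = map′ (λ (p , d) → vdec p d) (λ v → Vdec.proper v , Vdec.distinct v)
  (All.all? unique? (stars c) ×-dec AllPairs.allPairs? (λ xs ys → ¬? (same? xs ys)) (stars c))

-- A shape has only finitely many labellings below `k`, so the case distinction in the `extra`
-- outcome is constructive.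
search : ∀ k t {P : Lab ℕ t → Set} → (∀ c → Dec (P c)) → Dec (∃ λ c → All (_< k) (labels c) × P c)
search k ∅ P? = map′ (λ p → ∅ , [] , p) (λ { (∅ , _ , p) → p }) (P? ∅)
search k (br t u) P? = map′
  (λ (a , a<k , c , bc , s , bs , p) → br a c s , a<k ∷ AllP.++⁺ bc bs , p)
  (λ { (br a c s , a<k ∷ b , p) → a , a<k , c , ++⁻ˡ (labels c) b , s , ++⁻ʳ (labels c) b , p })
  (anyUpTo? (λ a → search k t λ c → search k u λ s → P? (br a c s)) k)

relab-heads : ∀ {A B : Set} {t} (f : A → B) (x : Lab A t) → heads (relab f x) ≡ map f (heads x)
relab-heads f ∅ = refl
relab-heads f (br a c s) = cong (f a ∷_) (relab-heads f s)

relab-below : ∀ {A B : Set} {t} (f : A → B) (x : Lab A t) → below (relab f x) ≡ map (map f) (below x)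
relab-below f ∅ = refl
relab-below f (br a c s) = cong₂ _∷_ (cong (f a ∷_) (relab-heads f c))
  (trans (cong₂ _++_ (relab-below f c) (relab-below f s)) (sym (map-++ (map f) (below c) (below s))))

relab-stars : ∀ {A B : Set} {t} (f : A → B) (x : Lab A t) → stars (relab f x) ≡ map (map f) (stars x)
relab-stars f x = cong₂ _∷_ (relab-heads f x) (relab-below f x)

relab-labels : ∀ {A B : Set} {t} (f : A → B) (x : Lab A t) → labels (relab f x) ≡ map f (labels x)
relab-labels f ∅ = refl
relab-labels f (br a c s) = cong (f a ∷_)
  (trans (cong₂ _++_ (relab-labels f c) (relab-labels f s)) (sym (map-++ f (labels c) (labels s))))

relab-cong : ∀ {A B : Set} {t} {f g : A → B} (x : Lab A t) → (∀ {a} → a ∈ labels x → f a ≡ g a)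
    → relab f x ≡ relab g x
relab-cong ∅ h = refl
relab-cong (br a c s) h rewrite h (here refl)
  | relab-cong c (λ i → h (there (∈-++⁺ˡ i))) | relab-cong s (λ i → h (there (∈-++⁺ʳ (labels c) i))) = refl

module _ {m : ℕ} where
  open DecMem (FinP._≟_ {m}) using () renaming (_∈?_ to _∈ᶠ?_)

  -- Each edge occurs once in the tree, so a labelling of the shape is the trace of a function on
  -- edges.
  realise : ∀ {t} (x : Lab (Fin m) t) → Unique (labels x) → (c : Lab ℕ t) → ∃ λ π → relab π x ≡ c
  realise ∅ _ ∅ = (λ _ → 0) , refl
  realise (br e x y) (p ∷ u) (br a c s) with Unique-++⁻ (labels x) u
  ... | ux , uy , d with realise x ux c | realise y uy s
  ... | π , refl | ρ , refl = f , same
    where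
    f : Fin m → ℕ
    f e' with e' FinP.≟ e | e' ∈ᶠ? labels x
    ... | yes _ | _     = a
    ... | no _  | yes _ = π e'
    ... | no _  | no _  = ρ e'
    f-e : f e ≡ a
    f-e with e FinP.≟ e | e ∈ᶠ? labels x
    ... | yes _ | _ = refl
    ... | no n  | _ = ⊥-elim (n refl)
    f-x : ∀ {e'} → e' ∈ labels x → f e' ≡ π e'
    f-x {e'} i with e' FinP.≟ e | e' ∈ᶠ? labels x
    ... | yes refl | _ = ⊥-elim (All.lookup (++⁻ˡ (labels x) p) i refl)
    ... | no _ | yes _ = refl
    ... | no _ | no n  = ⊥-elim (n i)
    f-y : ∀ {e'} → e' ∈ labels y → f e' ≡ ρ e'
    f-y {e'} i with e' FinP.≟ e | e' ∈ᶠ? labels x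
    ... | yes refl | _ = ⊥-elim (All.lookup (++⁻ʳ (labels x) p) i refl)
    ... | no _ | yes j = ⊥-elim (d j i)
    ... | no _ | no _  = refl
    same : relab f (br e x y) ≡ br a (relab π x) (relab ρ y)
    same rewrite f-e | relab-cong x f-x | relab-cong y f-y = refl

map-unique⁻ : ∀ {A B : Set} {f : A → B} {xs x y} → Unique (map f xs) → x ∈ xs → y ∈ xs → f x ≡ f y → x ≡ y
map-unique⁻ (p ∷ u) (here refl) (here refl) q = refl
map-unique⁻ {f = f} (p ∷ u) (here refl) (there j) q = ⊥-elim (All.lookup p (∈-map⁺ f j) q)
map-unique⁻ {f = f} (p ∷ u) (there i) (here refl) q = ⊥-elim (All.lookup p (∈-map⁺ f i) (sym q))
map-unique⁻ (p ∷ u) (there i) (there j) q = map-unique⁻ u i j q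

map-unique⁺ : ∀ {A B : Set} {f : A → B} {xs} → (∀ {x y} → x ∈ xs → y ∈ xs → f x ≡ f y → x ≡ y) → Unique xs
    → Unique (map f xs)
map-unique⁺ h [] = []
map-unique⁺ {f = f} {xs = x ∷ xs} h (p ∷ u) = All.tabulate
  (λ i q → let y , j , r = ∈-map⁻ f i in All.lookup p j (h (here refl) (there j) (trans q r)))
  ∷ map-unique⁺ (λ i j → h (there i) (there j)) u

-- From shapes to graphs

module Transfer {n} (G : Graph n) (R : Rooted G) where
  open Rooted R

  star-of : ∀ v → ∃ λ s → (v , s) ∈ at
  star-of v with ∈-map⁻ proj₁ (vertices-all v)
  ... | (_ , s) , i , refl = s , i

  ∈stars : ∀ {v s} → (v , s) ∈ at → s ∈ stars tree
  ∈stars i = subst (_ ∈_) at-stars (∈-map⁺ proj₂ i)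

  degree-star : ∀ {v s} → (v , s) ∈ at → degree G v ≡ length s
  degree-star {v} {s} i = ↭-length (unique-↭
    (UniqueP.filter⁺ (incident? G v) (UniqueP.allFin⁺ _)) (All.lookup stars-unique (∈stars i))
    (λ j → complete i (proj₂ (∈-filter⁻ (incident? G v) {xs = allFin _} j)))
    (λ j → ∈-filter⁺ (incident? G v) (∈-allFin _) (sound i j)))

  edges-↭ : allFin (∣E∣ G) ↭ labels tree
  edges-↭ = unique-↭ (UniqueP.allFin⁺ _) edges-unique (λ _ → edges-all _) (λ _ → ∈-allFin _)

  edges-size : ∣E∣ G ≡ size shape
  edges-size = trans (sym (length-tabulate id)) (trans (↭-length edges-↭) (length-labels tree))

  vertices-↭ : allFin n ↭ map proj₁ at
  vertices-↭ = unique-↭ (UniqueP.allFin⁺ _) vertices-unique (λ _ → vertices-all _) (λ _ → ∈-allFin _)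

  vertices-size : n ≡ suc (size shape)
  vertices-size = trans (sym (length-tabulate id)) (trans (↭-length vertices-↭) (trans (length-map proj₁ at)
    (trans (sym (length-map proj₂ at)) (trans (cong length at-stars) (cong suc (length-below tree))))))

  degree-count : ∀ d → n[ d ] G ≡ ofLength d (stars tree)
  degree-count d = trans (↭-length (filter-↭ (λ v → degree G v ≟ d) vertices-↭))
    (trans (go at (λ i → i)) (cong (ofLength d) at-stars))
    where
    go : ∀ l → (∀ {x} → x ∈ l → x ∈ at) → length (filter (λ v → degree G v ≟ d) (map proj₁ l))
        ≡ ofLength d (map proj₂ l)
    go [] h = refl
    go ((v , s) ∷ l) h with length s ≟ d
    ... | yes q = trans (cong length (filter-accept (λ v → degree G v ≟ d) (trans (degree-star (h
          (here refl))) q)))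
                    (trans (cong suc (go l (h ∘ there))) (sym (ofLength-≡ d s (map proj₂ l) q)))
    ... | no q  = trans (cong length (filter-reject (λ v → degree G v ≟ d) (q ∘ trans (sym (degree-star (h
          (here refl)))))))
                    (trans (go l (h ∘ there)) (sym (ofLength-≢ d s (map proj₂ l) q)))

  module _ {k} (π : Colouring G k) where
    colour : Edge G → ℕ
    colour = toℕ ∘ π

    coloured : Lab ℕ shape
    coloured = relab colour tree

    coloured-bounded : All (_< k) (labels coloured)
    coloured-bounded = subst (All (_< k)) (sym (relab-labels colour tree)) (AllP.map⁺ (All.tabulate
        λ {e} _ → FinP.toℕ<n (π e)))

    coloured-vdec : IsVdec G π → Vdec coloured
    coloured-vdec (pr , di) = vdec
      (subst (All Unique) eq (AllP.map⁺ (All.tabulate star-unique)))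
      (subst (AllPairs Differ) eq (APP.map⁺ (go at (λ i → i) vertices-unique)))
      where
      eq : map (map colour ∘ proj₂) at ≡ stars coloured
      eq = trans (map-∘ at) (trans (cong (map (map colour)) at-stars) (sym (relab-stars colour tree)))
      star-unique : ∀ {vs} → vs ∈ at → Unique (map colour (proj₂ vs))
      star-unique {v , s} i = map-unique⁺ (λ {e} {f} j l q → inj e f j l q) (All.lookup stars-unique (∈stars i))
        where
        inj : ∀ e f → e ∈ s → f ∈ s → colour e ≡ colour f → e ≡ f
        inj e f j l q with e FinP.≟ f
        ... | yes r = r
        ... | no r = ⊥-elim (pr v e f (sound i j) (sound i l) r (FinP.toℕ-injective q))
      transfer : ∀ {u s v s'} → (u , s) ∈ at → (v , s') ∈ at →
                 (∀ x → x ∈ map colour s → x ∈ map colour s') → ∀ {a} → InColourSet G π u a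
                     → InColourSet G π v a
      transfer i j f (e , inc , refl) with ∈-map⁻ colour (f _ (∈-map⁺ colour (complete i inc)))
      ... | e' , k , q = e' , sound j k , sym (FinP.toℕ-injective q)
      differs : ∀ {u s v s'} → (u , s) ∈ at → (v , s') ∈ at → u ≢ v → Differ (map colour s) (map colour s')
      differs i j u≢v (f , g) = di _ _ u≢v λ a → mk⇔ (transfer i j f) (transfer j i g)
      go : ∀ l → (∀ {x} → x ∈ l → x ∈ at) → Unique (map proj₁ l) → AllPairs (λ p q → Differ (map colour
          (proj₂ p)) (map colour (proj₂ q))) l
      go [] h u = []
      go (_ ∷ l) h (p ∷ u) = All.tabulate (λ i → differs (h (here refl)) (h (there i)) (All.lookup p
          (∈-map⁺ proj₁ i))) ∷ go l (h ∘ there) u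

  equitable-vdec : ∀ {K lo} → Colourable K lo shape → HasEquitableVdec G K
  equitable-vdec {K} {lo} (c , g) with realise tree edges-unique c
  ... | π₀ , refl = π , (prop , dist) , equi
    where
    open Good g
    π₀<K : ∀ e → π₀ e < K
    π₀<K e = All.lookup bounded (subst (_ ∈_) (sym (relab-labels π₀ tree)) (∈-map⁺ π₀ (edges-all e)))
    π : Colouring G K
    π e = fromℕ< (π₀<K e)
    toℕ-π : ∀ e → toℕ (π e) ≡ π₀ e
    toℕ-π e = FinP.toℕ-fromℕ< (π₀<K e)
    π₀-cong : ∀ {e f} → π e ≡ π f → π₀ e ≡ π₀ f
    π₀-cong {e} {f} q = trans (sym (toℕ-π e)) (trans (cong toℕ q) (toℕ-π f))
    eq : stars (relab π₀ tree) ≡ map (map π₀ ∘ proj₂) at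
    eq = trans (relab-stars π₀ tree) (trans (cong (map (map π₀)) (sym at-stars)) (sym (map-∘ at)))
    prop : Proper G π
    prop v e f ie if e≢f q with star-of v
    ... | s , i = e≢f (map-unique⁻ (All.lookup (subst (All Unique) (relab-stars π₀ tree) proper) (∈-map⁺
          (map π₀) (∈stars i)))
                        (complete i ie) (complete i if) (π₀-cong q))
    dist : ∀ u v → ¬ u ≡ v → ¬ SameColourSet G π u v
    dist u v u≢v same with star-of u | star-of v
    ... | s , i | s' , j = sep (AllPairs-∈ (APP.map⁻ (subst (AllPairs Differ) eq distinct)) i j)
      where
      half : ∀ {u v s s'} → (u , s) ∈ at → (v , s') ∈ at → (∀ a → InColourSet G π u a → InColourSet G π v a) →
             ∀ x → x ∈ map π₀ s → x ∈ map π₀ s'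
      half {s' = s'} i j f x m with ∈-map⁻ π₀ m
      ... | e , k , refl with f (π e) (e , sound i k , refl)
      ... | e' , inc , q = subst (_∈ map π₀ s') (π₀-cong q) (∈-map⁺ π₀ (complete j inc))
      sameStars : Same (map π₀ s) (map π₀ s')
      sameStars = half i j (λ a → Equivalence.to (same a)) , half j i (λ a → Equivalence.from (same a))
      sep : _ → ⊥
      sep (inj₁ q)        = u≢v (cong proj₁ q)
      sep (inj₂ (inj₁ d)) = d sameStars
      sep (inj₂ (inj₂ d)) = d (Same-sym sameStars)
    class-count : ∀ a → classSize G π a ≡ count (toℕ a) (labels (relab π₀ tree))
    class-count a = trans (↭-length (filter-↭ (λ e → π e FinP.≟ a) edges-↭))
      (trans (go (labels tree)) (cong (count (toℕ a)) (sym (relab-labels π₀ tree))))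
      where
      go : ∀ es → length (filter (λ e → π e FinP.≟ a) es) ≡ count (toℕ a) (map π₀ es)
      go [] = refl
      go (e ∷ es) with π e FinP.≟ a
      ... | yes q = trans (cong suc (go es)) (sym (trans (cong (λ x → count (toℕ a) (x ∷ map π₀ es))
            (trans (sym (toℕ-π e)) (cong toℕ q)))
                      (count-≡ (toℕ a) (map π₀ es))))
      ... | no q = trans (go es) (sym (count-≢ (toℕ a) (map π₀ es) λ r → q (FinP.toℕ-injective (trans
            (toℕ-π e) (sym r)))))
    equi : Equitable G π
    equi a b rewrite class-count a | class-count b =
      ≤-trans (proj₂ (balanced (toℕ a) (FinP.toℕ<n a))) (s≤s (proj₁ (balanced (toℕ b) (FinP.toℕ<n b))))

-- Combining lower bound and colourings

pleaves≥1 : ∀ t → 1 ≤ pleaves t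
pleaves≥1 ∅ = ≤-refl
pleaves≥1 (br c s) = ≤-trans (pleaves≥1 c) (m≤m+n (pleaves c) (leaves s))

nleaves≥2 : ∀ c s → 2 ≤ nleaves (br c s)
nleaves≥2 c s = +-mono-≤ (pleaves≥1 c) (pleaves≥1 s)

nleaves≤size : ∀ t → 2 ≤ size t → nleaves t ≤ size t
nleaves≤size (br ∅ ∅) (s≤s ())
nleaves≤size (br ∅ s@(br _ _)) _ = s≤s (leaves≤size s)
nleaves≤size (br c@(br _ _) ∅) _ = subst (nleaves (br c ∅) ≤_) (+-comm _ 1)
  (≤-trans (+-monoˡ-≤ 1 (leaves≤size c)) (+-monoˡ-≤ 1 (m≤m+n (size c) 0)))
nleaves≤size (br c@(br _ _) s@(br _ _)) _ = m≤n⇒m≤1+n (+-mono-≤ (leaves≤size c) (leaves≤size s))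

theorem2 : ∀ (n : ℕ) (T : Graph n) → IsTree T → 3 ≤ n →
    n[ 2 ] T ≤ n[ 1 ] T →
    ∣E∣ T ≤ 2 * (n[ 1 ] T + 1) →
    Σ ℕ λ k → IsChiS T k × IsChiES T k
theorem2 (suc n) T isTree 3≤n n₂≤n₁ E≤ = go (outcome shape k (size shape ∸ k) k≥2 (sym
    (m+[n∸m]≡n k≤E)) refl tw m≤)
  where
  R = Build.rooted T isTree Fin.zero
  open Rooted R
  open Transfer T R

  k = nleaves shape
  size≥2 : 2 ≤ size shape
  size≥2 = s≤s⁻¹ (subst (3 ≤_) vertices-size 3≤n)
  k≤E : k ≤ size shape
  k≤E = nleaves≤size shape size≥2

  shaped : ∀ {t} (x : Lab (Edge T) t) → 2 ≤ size t → ofLength 1 (stars x) ≡ nleaves t × ofLength 2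
      (stars x) ≡ twos t × 2 ≤ nleaves t × Nonempty t
  shaped x@(br {c} {s} _ _ _) _ = stars-leaves x , stars-twos x , nleaves≥2 c s , nonempty
  facts = shaped tree size≥2
  n₁≡k : n[ 1 ] T ≡ k
  n₁≡k = trans (degree-count 1) (proj₁ facts)
  k≥2 = proj₁ (proj₂ (proj₂ facts))
  tw : twos shape ≤ k
  tw = subst₂ _≤_ (trans (degree-count 2) (proj₁ (proj₂ facts))) n₁≡k n₂≤n₁
  m≤ : size shape ∸ k ≤ k + 2
  m≤ = m≤n+o⇒m∸n≤o (size shape) k (subst₂ _≤_ edges-size (trans (cong (λ x → 2 * (x + 1)) n₁≡k) e) E≤)
    where
    e : 2 * (k + 1) ≡ k + (k + 2)
    e = trans (*-distribˡ-+ 2 k 1) (trans (cong (_+ 2) (cong (k +_) (+-identityʳ k))) (+-assoc k k 2))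

  lower : ∀ j → HasVdec T j → k ≤ j
  lower j (π , v) = bound tree (coloured-bounded π) (coloured-vdec π v)
    where
    bound : ∀ {t} (x : Lab (Edge T) t) → All (_< j) (labels (relab (colour π) x)) → Vdec (relab
        (colour π) x) → nleaves t ≤ j
    bound ∅ _ _ = z≤n
    bound x@(br _ _ _) b v = leaves-bound (relab (colour π) x) b v

  conclude : ∀ K → HasEquitableVdec T K → (∀ j → HasVdec T j → K ≤ j) → Σ ℕ λ K → IsChiS T K × IsChiES T K
  conclude K h@(π , v , _) low = K , ((π , v) , low) , (h , λ { j (ρ , w , _) → low j (ρ , w) })

  go : Outcome shape k → Σ ℕ λ k → IsChiS T k × IsChiES T k
  go (equitable lo col) = conclude k (equitable-vdec col) lower
  go (extra small col) with search k shape vdec?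
  -- With `k` colours ruled out, the lower bound rises to `suc k`, and the equitable colouring
  -- attains it.
  ... | no none = conclude (suc k) (equitable-vdec col) λ j h → ≤∧≢⇒< (lower j h) (λ { refl → none (found h) })
    where
    found : HasVdec T k → ∃ λ c → All (_< k) (labels c) × Vdec c
    found (π , v) = coloured π , coloured-bounded π , coloured-vdec π v
  -- The labelling found is itself equitable, as re-rooting to a shallow shape shows.
  ... | yes (c , b , v) = conclude k (equitable-vdec (improve (proj₂ (proj₂ (proj₂ facts))) small c b v)) lower
    where
    improve : ∀ {t} → Nonempty t → size t ≤ nleaves t + 2 → (c : Lab ℕ t) → All (_< nleaves t) (labels c)
        → Vdec c → Colourable (nleaves t) 0 t
    improve (nonempty {x} {y}) h c b v with shallow x y h
    ... | ∅ , p , _ = ⊥-elim (1+n≢0 (size-≈ p))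
    ... | t'@(br _ _) , p , sh = Colourable-≈ (≈-sym p) (relabel p c ,
      shallow-good (relabel p c) sh nonempty (sym (nleaves-≈ p))
        (All-resp-↭ (relabel-labels p c) b) (Vdec-≋ (relabel-stars p c) v))
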